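{- Let $G$ be a profinite group, $(A,B,C)$ a Tate product over $G$, and $r,s\ge0$ integers. Let $\alpha''\in H^r(G,A'')$ and $\beta''\in H^s(G,B'')$, and choose cochains $f\in C^r(G,A)$, $g\in C^s(G,B)$ such that $j_*f\in Z^r(G,A'')$ represents $\alpha''$ and $j_*g\in Z^s(G,B'')$ represents $\beta''$. Then: (a) $d_rf\in C^{r+1}(G,A')$ and $d_sg\in C^{s+1}(G,B')$, so that the cup products $d_rf\cup g$ (via $A'\times B\to C$) and $f\cup d_sg$ (via $A\times B'\to C$) are defined. (b) $d_rf\cup g+(-1)^rf\cup d_sg\in C^{r+s+1}(G,C)$ is a cocycle. (c) The cohomology class $[d_rf\cup g+(-1)^rf\cup d_sg]\in H^{r+s+1}(G,C)$ depends only on $\alpha''$ and $\beta''$, not on the choice of $f$ and $g$. Consequently the augmented cup product $\cup_{\mathrm{aug}}:H^r(G,A'')\times H^s(G,B'')\to H^{r+s+1}(G,C)$, $\alpha''\cup_{\mathrm{aug}}\beta''=[d_rf\cup g+(-1)^rf\cup d_sg]$, is well defined.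
   Context: For a discrete $G$-module $A$, $C^r(G,A)$ is the group of continuous maps $G^r\to A$, with coboundary $d_rf(x_1,\ldots,x_{r+1})=x_1 f(x_2,\ldots,x_{r+1})+\sum_{i=1}^r(-1)^i f(x_1,\ldots,x_ix_{i+1},\ldots,x_{r+1})+(-1)^{r+1}f(x_1,\ldots,x_r)$; $Z^r=\ker d_r$, $B^r=\operatorname{im} d_{r-1}$, $H^r=Z^r/B^r$. A map $A\times B\to C$, $(a,b)\mapsto a\times b$, of discrete $G$-modules is $G$-bilinear if it is bilinear and $g(a\times b)=ga\times gb$. It induces the cup product $\cup:C^r(G,A)\times C^s(G,B)\to C^{r+s}(G,C)$, $(f\cup g)(x_1,\ldots,x_{r+s})=f(x_1,\ldots,x_r)\times x_1\cdots x_r\, g(x_{r+1},\ldots,x_{r+s})$. A Tate product $(A,B,C)$ over $G$ consists of two short exact sequences of discrete $G$-modules $0\to A'\xrightarrow{i}A\xrightarrow{j}A''\to0$ and $0\to B'\xrightarrow{i}B\xrightarrow{j}B''\to0$, a discrete $G$-module $C$, and two $G$-bilinear maps $A'\times B\to C$ and $A\times B'\to C$ that coincide on $A'\times B'$. One identifies $C^r(G,A')$ with $\ker(j_*:C^r(G,A)\to C^r(G,A''))$, and similarly for $B'$. -}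

module Defs where

open import Algebra.Bundles using (Group; AbelianGroup)
open import Algebra.Morphism.Structures using (IsGroupHomomorphism)
open import Algebra.Structures using (IsAbelianGroup)
import Algebra.Properties.AbelianGroup as AbelianGroupProperties
import Algebra.Properties.CommutativeMonoid.Sum as Sum
import Algebra.Properties.CommutativeSemigroup as CommutativeSemigroupProperties
open import Data.Fin.Base using (Fin; zero; suc; toℕ)
open import Data.List.Base using (List)
open import Data.List.Relation.Unary.Any using (Any)
open import Data.Nat.Base using (ℕ; zero; suc; _+_)
open import Data.Nat.Properties using (+-suc)
open import Data.Product.Base using (Σ; Σ-syntax; ∃; _×_; _,_; proj₁; proj₂; uncurry)
open import Data.Product.Relation.Binary.Pointwise.NonDependent using (×-setoid)
open import Data.Unit.Polymorphic.Base using (⊤)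
open import Data.Vec.Base
  using (Vec; []; _∷_; lookup; head; tail; init; take; drop; foldr′)
open import Data.Vec.Relation.Binary.Pointwise.Inductive as Pointwise using ()
open import Function.Base using (id; _∘_)
open import Function.Bundles using (_⇔_)
open import Function.Definitions using (Injective; StrictlySurjective)
open import Level using (Level; Lift; lift) renaming (suc to lsuc)
open import Relation.Binary.Bundles using (Setoid)
open import Relation.Binary.PropositionalEquality as ≡
  using (_≡_; refl; sym; trans; cong; cong₂; subst; _≗_)
open import Relation.Nullary using (¬_)
open import Relation.Unary using (Pred; _∈_; _⊆_; _≐_; _∩_; _∪_; _⊢_; ⋃; Satisfiable; Empty)

private
  variable
    ℓ : Level

record Topology (S : Setoid ℓ ℓ) : Set (lsuc (lsuc ℓ)) where
  open Setoid S using (Carrier; _≈_)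
  field
    Open      : Pred Carrier ℓ → Set (lsuc ℓ)
    Open-≈    : ∀ {U} → Open U → ∀ {x y} → x ≈ y → x ∈ U → y ∈ U
    Open-≐    : ∀ {U V} → U ≐ V → Open U → Open V
    Open-full : Open (λ _ → ⊤)
    Open-∩    : ∀ {U V} → Open U → Open V → Open (U ∩ V)
    Open-⋃    : {I : Set ℓ} {U : I → Pred Carrier ℓ} →
                (∀ i → Open (U i)) → Open (⋃ I U)

open Topology using (Open)

-- Open sets respect _≈_, so a continuous map into a discrete space
-- automatically respects _≈_ as well; see Cochain.fun-cong.
Continuous : {S₁ S₂ : Setoid ℓ ℓ} → Topology S₁ → Topology S₂ →
             (Setoid.Carrier S₁ → Setoid.Carrier S₂) → Set (lsuc ℓ)
Continuous T₁ T₂ f = ∀ V → Open T₂ V → Open T₁ (f ⊢ V)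

discrete : (A : Set ℓ) → Topology (≡.setoid A)
discrete A = record
  { Open      = λ _ → ⊤
  ; Open-≈    = λ { _ refl x∈U → x∈U }
  ; Open-≐    = _
  ; Open-full = _
  ; Open-∩    = _
  ; Open-⋃    = _
  }

infixr 2 _×ᵗ_

_×ᵗ_ : {S₁ S₂ : Setoid ℓ ℓ} → Topology S₁ → Topology S₂ → Topology (×-setoid S₁ S₂)
_×ᵗ_ {ℓ} {S₁} {S₂} T₁ T₂ = record
  { Open      = λ W → ∀ p → p ∈ W →
                  Σ[ U ∈ Pred (S₁ .Carrier) ℓ ] Σ[ V ∈ Pred (S₂ .Carrier) ℓ ]
                    Open T₁ U × Open T₂ V × proj₁ p ∈ U × proj₂ p ∈ V ×
                    (∀ q → proj₁ q ∈ U → proj₂ q ∈ V → q ∈ W)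
  ; Open-≈    = λ W-open {p} {q} (p≈q₁ , p≈q₂) p∈W →
                  let U , V , U-open , V-open , p∈U , p∈V , UV⊆W = W-open p p∈W in
                  UV⊆W q (T₁.Open-≈ U-open p≈q₁ p∈U) (T₂.Open-≈ V-open p≈q₂ p∈V)
  ; Open-≐    = λ (W⊆W′ , W′⊆W) W-open p p∈W′ →
                  let U , V , U-open , V-open , p∈U , p∈V , UV⊆W = W-open p (W′⊆W p∈W′) in
                  U , V , U-open , V-open , p∈U , p∈V , λ q q∈U q∈V → W⊆W′ (UV⊆W q q∈U q∈V)
  ; Open-full = λ p _ → _ , _ , T₁.Open-full , T₂.Open-full , _
  ; Open-∩    = λ W-open W′-open p (p∈W , p∈W′) →
                  let U  , V  , U-open  , V-open  , p∈U  , p∈V  , UV⊆W   = W-open p p∈W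
                      U′ , V′ , U′-open , V′-open , p∈U′ , p∈V′ , UV⊆W′  = W′-open p p∈W′
                  in U ∩ U′ , V ∩ V′ , T₁.Open-∩ U-open U′-open , T₂.Open-∩ V-open V′-open ,
                     (p∈U , p∈U′) , (p∈V , p∈V′) ,
                     λ q (q∈U , q∈U′) (q∈V , q∈V′) → UV⊆W q q∈U q∈V , UV⊆W′ q q∈U′ q∈V′
  ; Open-⋃    = λ W-open p (i , p∈Wᵢ) →
                  let U , V , U-open , V-open , p∈U , p∈V , UV⊆W = W-open i p p∈Wᵢ in
                  U , V , U-open , V-open , p∈U , p∈V , λ q q∈U q∈V → i , UV⊆W q q∈U q∈V
  }
  where
  open Setoid using (Carrier)
  module T₁ = Topology T₁
  module T₂ = Topology T₂

-- The product topology on the n-fold power.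
_^ᵗ_ : {S : Setoid ℓ ℓ} → Topology S → (n : ℕ) → Topology (Pointwise.setoid S n)
_^ᵗ_ {ℓ} {S} T n = record
  { Open      = λ W → ∀ xs → xs ∈ W →
                  Σ[ U ∈ (Fin n → Pred Carrier ℓ) ]
                    (∀ i → Open T (U i)) × (∀ i → lookup xs i ∈ U i) ×
                    (∀ ys → (∀ i → lookup ys i ∈ U i) → ys ∈ W)
  ; Open-≈    = λ W-open {xs} {ys} xs≈ys xs∈W →
                  let U , U-open , xs∈U , U⊆W = W-open xs xs∈W in
                  U⊆W ys λ i → Open-≈ (U-open i) (Pointwise.lookup xs≈ys i) (xs∈U i)
  ; Open-≐    = λ (W⊆W′ , W′⊆W) W-open xs xs∈W′ →
                  let U , U-open , xs∈U , U⊆W = W-open xs (W′⊆W xs∈W′) in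
                  U , U-open , xs∈U , λ ys ys∈U → W⊆W′ (U⊆W ys ys∈U)
  ; Open-full = λ xs _ → (λ _ _ → ⊤) , (λ _ → Open-full) , _
  ; Open-∩    = λ W-open W′-open xs (xs∈W , xs∈W′) →
                  let U  , U-open  , xs∈U  , U⊆W   = W-open xs xs∈W
                      U′ , U′-open , xs∈U′ , U′⊆W′ = W′-open xs xs∈W′
                  in (λ i → U i ∩ U′ i) , (λ i → Open-∩ (U-open i) (U′-open i)) ,
                     (λ i → xs∈U i , xs∈U′ i) ,
                     λ ys ys∈ → U⊆W ys (proj₁ ∘ ys∈) , U′⊆W′ ys (proj₂ ∘ ys∈)
  ; Open-⋃    = λ W-open xs (j , xs∈W) →
                  let U , U-open , xs∈U , U⊆W = W-open j xs xs∈W in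
                  U , U-open , xs∈U , λ ys ys∈U → j , U⊆W ys ys∈U
  }
  where
  open Setoid S using (Carrier)
  open Topology T hiding (Open)

module _ {S : Setoid ℓ ℓ} (T : Topology S) where
  open Setoid S using (Carrier; _≈_)

  IsCompact : Set (lsuc ℓ)
  IsCompact = {I : Set ℓ} (U : I → Pred Carrier ℓ) → (∀ i → Open T (U i)) →
              (∀ x → ∃ λ i → x ∈ U i) →
              ∃ λ (is : List I) → ∀ x → Any (λ i → x ∈ U i) is

  IsHausdorff : Set (lsuc ℓ)
  IsHausdorff = ∀ x y → ¬ (x ≈ y) →
                Σ[ U ∈ Pred Carrier ℓ ] Σ[ V ∈ Pred Carrier ℓ ]
                  Open T U × Open T V × x ∈ U × y ∈ V × Empty (U ∩ V)

  IsConnected : Pred Carrier ℓ → Set (lsuc ℓ)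
  IsConnected P = ∀ U V → Open T U → Open T V → P ⊆ U ∪ V →
                  Satisfiable (P ∩ U) → Satisfiable (P ∩ V) → Satisfiable (P ∩ (U ∩ V))

  IsTotallyDisconnected : Set (lsuc ℓ)
  IsTotallyDisconnected = ∀ P → IsConnected P → ∀ x y → x ∈ P → y ∈ P → x ≈ y

module _ {S₁ S₂ : Setoid ℓ ℓ} (T₁ : Topology S₁) (T₂ : Topology S₂) where

  continuous-≗ : ∀ {f g} → f ≗ g → Continuous T₁ T₂ f → Continuous T₁ T₂ g
  continuous-≗ f≗g f-cont V V-open = Topology.Open-≐ T₁
    ( (λ {x} → subst V (f≗g x)) , (λ {x} → subst V (sym (f≗g x))) ) (f-cont V V-open)

  constant-continuous : ∀ y → Continuous T₁ T₂ (λ _ → y)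
  constant-continuous y V V-open = Topology.Open-≐ T₁
    ((λ (y∈V , _) → y∈V) , (λ y∈V → y∈V , _))
    (Topology.Open-⋃ T₁ {I = y ∈ V} (λ _ → Topology.Open-full T₁))

module _ {S₁ S₂ S₃ : Setoid ℓ ℓ}
         (T₁ : Topology S₁) (T₂ : Topology S₂) (T₃ : Topology S₃) where

  continuous-∘ : ∀ {f g} → Continuous T₂ T₃ g → Continuous T₁ T₂ f → Continuous T₁ T₃ (g ∘ f)
  continuous-∘ g-cont f-cont V V-open = f-cont _ (g-cont V V-open)

  ×-continuous : ∀ {f g} → Continuous T₁ T₂ f → Continuous T₁ T₃ g →
                 Continuous T₁ (T₂ ×ᵗ T₃) (λ x → f x , g x)
  ×-continuous {f} {g} f-cont g-cont W W-open = Topology.Open-≐ T₁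
    ( (λ { {x} ((y , y∈W) , fx∈U , gx∈V) →
           let _ , _ , _ , _ , _ , _ , UV⊆W = W-open _ y∈W in UV⊆W _ fx∈U gx∈V })
    , (λ {x} x∈W →
           let _ , _ , _ , _ , x∈U , x∈V , _ = W-open _ x∈W in (x , x∈W) , x∈U , x∈V) )
    (Topology.Open-⋃ T₁ {I = Σ[ x ∈ Setoid.Carrier S₁ ] (f x , g x) ∈ W} λ (x , x∈W) →
      let U , V , U-open , V-open , _ = W-open _ x∈W in
      Topology.Open-∩ T₁ (f-cont U U-open) (g-cont V V-open))

module _ {S : Setoid ℓ ℓ} (T : Topology S) {A B : Set ℓ} where

  discrete-map₁ : ∀ {f} (h : A → B) → Continuous T (discrete A) f →
                  Continuous T (discrete B) (h ∘ f)
  discrete-map₁ h f-cont V _ = f-cont (h ⊢ V) _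

  discrete-map₂ : {D : Set ℓ} → ∀ {f g} (h : A → B → D) →
                  Continuous T (discrete A) f → Continuous T (discrete B) g →
                  Continuous T (discrete D) (λ x → h (f x) (g x))
  discrete-map₂ h f-cont g-cont V _ =
    ×-continuous T (discrete A) (discrete B) f-cont g-cont (uncurry h ⊢ V)
      λ { (a , b) ab∈V → (a ≡_) , (b ≡_) , _ , _ , refl , refl ,
                         λ { _ refl refl → ab∈V } }

module _ {S : Setoid ℓ ℓ} (T : Topology S) where

  head-continuous : ∀ n → Continuous (T ^ᵗ suc n) T head
  head-continuous n V V-open (x ∷ xs) x∈V =
    (λ { zero → V ; (suc _) _ → ⊤ }) ,
    (λ { zero → V-open ; (suc _) → Topology.Open-full T }) ,
    (λ { zero → x∈V ; (suc _) → _ }) ,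
    (λ { (_ ∷ _) y∈ → y∈ zero })

  tail-continuous : ∀ n → Continuous (T ^ᵗ suc n) (T ^ᵗ n) tail
  tail-continuous n V V-open (x ∷ xs) xs∈V =
    let U , U-open , xs∈U , U⊆V = V-open xs xs∈V in
    (λ { zero _ → ⊤ ; (suc i) → U i }) ,
    (λ { zero → Topology.Open-full T ; (suc i) → U-open i }) ,
    (λ { zero → _ ; (suc i) → xs∈U i }) ,
    (λ { (_ ∷ ys) ys∈ → U⊆V ys (ys∈ ∘ suc) })

  ∷-continuous : ∀ {S₀ : Setoid ℓ ℓ} (T₀ : Topology S₀) n {f g} →
                 Continuous T₀ T f → Continuous T₀ (T ^ᵗ n) g →
                 Continuous T₀ (T ^ᵗ suc n) (λ x → f x ∷ g x)
  ∷-continuous T₀ n f-cont g-cont =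
    continuous-∘ T₀ (T ×ᵗ (T ^ᵗ n)) (T ^ᵗ suc n) cons
      (×-continuous T₀ T (T ^ᵗ n) f-cont g-cont)
    where
    cons : Continuous (T ×ᵗ (T ^ᵗ n)) (T ^ᵗ suc n) (uncurry _∷_)
    cons W W-open (x , xs) x∷xs∈W =
      let U , U-open , x∷xs∈U , U⊆W = W-open (x ∷ xs) x∷xs∈W in
      U zero , (λ ys → ∀ i → lookup ys i ∈ U (suc i)) , U-open zero ,
      (λ ys ys∈U → U ∘ suc , U-open ∘ suc , ys∈U , λ _ zs∈U → zs∈U) ,
      x∷xs∈U zero , x∷xs∈U ∘ suc ,
      λ (y , ys) y∈U ys∈U → U⊆W (y ∷ ys) λ { zero → y∈U ; (suc i) → ys∈U i }

  init-continuous : ∀ n → Continuous (T ^ᵗ suc n) (T ^ᵗ n) init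
  init-continuous zero =
    continuous-≗ (T ^ᵗ 1) (T ^ᵗ 0) (λ { (_ ∷ []) → refl })
      (constant-continuous (T ^ᵗ 1) (T ^ᵗ 0) [])
  init-continuous (suc n) =
    continuous-≗ (T ^ᵗ suc (suc n)) (T ^ᵗ suc n) (λ { (_ ∷ _) → refl })
      (∷-continuous (T ^ᵗ suc (suc n)) n (head-continuous (suc n))
        (continuous-∘ (T ^ᵗ suc (suc n)) (T ^ᵗ suc n) (T ^ᵗ n)
          (init-continuous n) (tail-continuous (suc n))))

  take-continuous : ∀ m n → Continuous (T ^ᵗ (m + n)) (T ^ᵗ m) (take m)
  take-continuous zero    n = constant-continuous (T ^ᵗ n) (T ^ᵗ 0) []
  take-continuous (suc m) n =
    continuous-≗ (T ^ᵗ suc (m + n)) (T ^ᵗ suc m) (λ { (_ ∷ _) → refl })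
      (∷-continuous (T ^ᵗ suc (m + n)) m (head-continuous (m + n))
        (continuous-∘ (T ^ᵗ suc (m + n)) (T ^ᵗ (m + n)) (T ^ᵗ m)
          (take-continuous m n) (tail-continuous (m + n))))

  drop-continuous : ∀ m n → Continuous (T ^ᵗ (m + n)) (T ^ᵗ n) (drop m)
  drop-continuous zero    n = λ V V-open → V-open
  drop-continuous (suc m) n =
    continuous-≗ (T ^ᵗ suc (m + n)) (T ^ᵗ n) (λ { (_ ∷ _) → refl })
      (continuous-∘ (T ^ᵗ suc (m + n)) (T ^ᵗ (m + n)) (T ^ᵗ n)
        (drop-continuous m n) (tail-continuous (m + n)))

record TopologicalGroup (ℓ : Level) : Set (lsuc (lsuc ℓ)) where
  field
    group : Group ℓ ℓ
  open Group group public
  field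
    topology      : Topology setoid
    ∙-continuous  : Continuous (topology ×ᵗ topology) topology (uncurry _∙_)
    ⁻¹-continuous : Continuous topology topology _⁻¹

record ProfiniteGroup (ℓ : Level) : Set (lsuc (lsuc ℓ)) where
  field
    topologicalGroup : TopologicalGroup ℓ
  open TopologicalGroup topologicalGroup public
  field
    compact             : IsCompact topology
    hausdorff           : IsHausdorff topology
    totallyDisconnected : IsTotallyDisconnected topology

-- sgn M n m is (-1)ⁿ m.
module _ {a b} (M : AbelianGroup a b) where
  open AbelianGroup M renaming (Carrier to ∣M∣)

  sgn : ℕ → ∣M∣ → ∣M∣
  sgn zero    m = m
  sgn (suc n) m = sgn n m ⁻¹

  sgn-∙ : ∀ n x y → sgn n (x ∙ y) ≈ sgn n x ∙ sgn n y
  sgn-∙ zero    x y = AbelianGroup.refl M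
  sgn-∙ (suc n) x y = AbelianGroup.trans M (⁻¹-cong (sgn-∙ n x y))
    (AbelianGroup.sym M (AbelianGroupProperties.⁻¹-∙-comm M _ _))

module ContinuousCohomology (G : TopologicalGroup ℓ) where
  private module G = TopologicalGroup G

  -- The equality of a module is propositional: its points are literally
  -- the points of a discrete space.
  record DiscreteModule : Set (lsuc (lsuc ℓ)) where
    infixr 7 _·_
    infixl 6 _⊕_
    infix  8 ⊖_
    field
      Carrier        : Set ℓ
      _⊕_            : Carrier → Carrier → Carrier
      𝟘              : Carrier
      ⊖_             : Carrier → Carrier
      isAbelianGroup : IsAbelianGroup _≡_ _⊕_ 𝟘 ⊖_
      _·_            : G.Carrier → Carrier → Carrier
      ·-identity     : ∀ a → G.ε · a ≡ a
      ·-assoc        : ∀ x y a → (x G.∙ y) · a ≡ x · (y · a)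
      ·-distrib-⊕    : ∀ x a b → x · (a ⊕ b) ≡ x · a ⊕ x · b
      ·-continuous   : Continuous (G.topology ×ᵗ discrete Carrier) (discrete Carrier) (uncurry _·_)

    abelianGroup : AbelianGroup ℓ ℓ
    abelianGroup = record { isAbelianGroup = isAbelianGroup }

    open Sum (AbelianGroup.commutativeMonoid abelianGroup) public using (sum)

  ∣_∣ : DiscreteModule → Set ℓ
  ∣_∣ = DiscreteModule.Carrier

  record ModuleHom (A B : DiscreteModule) : Set ℓ where
    private
      module A = DiscreteModule A
      module B = DiscreteModule B
    field
      map         : ∣ A ∣ → ∣ B ∣
      isGroupHom  : IsGroupHomomorphism (AbelianGroup.rawGroup A.abelianGroup)
                                        (AbelianGroup.rawGroup B.abelianGroup) map
      equivariant : ∀ x a → map (x A.· a) ≡ x B.· map a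

  record ShortExact (A′ A A″ : DiscreteModule) : Set ℓ where
    field
      i : ModuleHom A′ A
      j : ModuleHom A A″
    private
      module i = ModuleHom i
      module j = ModuleHom j
    field
      injective  : Injective _≡_ _≡_ i.map
      exact      : ∀ a → j.map a ≡ DiscreteModule.𝟘 A″ ⇔ ∃ λ a′ → i.map a′ ≡ a
      surjective : StrictlySurjective _≡_ j.map

  record Bilinear (A B C : DiscreteModule) : Set ℓ where
    private
      module A = DiscreteModule A
      module B = DiscreteModule B
      module C = DiscreteModule C
    field
      _⊠_         : ∣ A ∣ → ∣ B ∣ → ∣ C ∣
      distribˡ    : ∀ a b b₁ → a ⊠ (b B.⊕ b₁) ≡ (a ⊠ b) C.⊕ (a ⊠ b₁)
      distribʳ    : ∀ a a₁ b → (a A.⊕ a₁) ⊠ b ≡ (a ⊠ b) C.⊕ (a₁ ⊠ b)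
      equivariant : ∀ x a b → x C.· (a ⊠ b) ≡ (x A.· a) ⊠ (x B.· b)

  record TateProduct : Set (lsuc (lsuc ℓ)) where
    field
      A′ A A″   : DiscreteModule
      B′ B B″   : DiscreteModule
      C         : DiscreteModule
      A-exact   : ShortExact A′ A A″
      B-exact   : ShortExact B′ B B″
      pairing₁  : Bilinear A′ B C
      pairing₂  : Bilinear A B′ C

    open ShortExact A-exact public using () renaming (i to iᴬ; j to jᴬ)
    open ShortExact B-exact public using () renaming (i to iᴮ; j to jᴮ)
    open Bilinear pairing₁ using () renaming (_⊠_ to _⊠₁_)
    open Bilinear pairing₂ using () renaming (_⊠_ to _⊠₂_)

    field
      coincide : ∀ a′ b′ → a′ ⊠₁ ModuleHom.map iᴮ b′ ≡ ModuleHom.map iᴬ a′ ⊠₂ b′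

  record Cochain (r : ℕ) (A : DiscreteModule) : Set (lsuc ℓ) where
    constructor mkCochain
    field
      fun        : Vec G.Carrier r → ∣ A ∣
      continuous : Continuous (G.topology ^ᵗ r) (discrete ∣ A ∣) fun

    fun-cong : ∀ {xs ys} → Setoid._≈_ (Pointwise.setoid G.setoid r) xs ys → fun xs ≡ fun ys
    fun-cong {xs} xs≈ys =
      Topology.Open-≈ (G.topology ^ᵗ r) (continuous (fun xs ≡_) _) xs≈ys refl

  open Cochain

  module _ {r : ℕ} {A : DiscreteModule} where
    open DiscreteModule A

    infix  4 _≈ᶜ_
    infixl 6 _+ᶜ_ _-ᶜ_

    _≈ᶜ_ : Cochain r A → Cochain r A → Set ℓ
    f ≈ᶜ g = fun f ≗ fun g

    _+ᶜ_ : Cochain r A → Cochain r A → Cochain r A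
    f +ᶜ g = mkCochain (λ xs → fun f xs ⊕ fun g xs)
      (discrete-map₂ (G.topology ^ᵗ r) _⊕_ (continuous f) (continuous g))

    0ᶜ : Cochain r A
    0ᶜ = mkCochain (λ _ → 𝟘) (constant-continuous (G.topology ^ᵗ r) (discrete ∣ A ∣) 𝟘)

    negᶜ : Cochain r A → Cochain r A
    negᶜ f = mkCochain (λ xs → ⊖ fun f xs) (discrete-map₁ (G.topology ^ᵗ r) ⊖_ (continuous f))

    _-ᶜ_ : Cochain r A → Cochain r A → Cochain r A
    f -ᶜ g = f +ᶜ negᶜ g

  cochainGroup : ℕ → DiscreteModule → AbelianGroup (lsuc ℓ) ℓ
  cochainGroup r A = record
    { Carrier = Cochain r A
    ; _≈_ = _≈ᶜ_
    ; _∙_ = _+ᶜ_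
    ; ε   = 0ᶜ
    ; _⁻¹ = negᶜ
    ; isAbelianGroup = record
      { isGroup = record
        { isMonoid = record
          { isSemigroup = record
            { isMagma = record
              { isEquivalence = record
                { refl  = λ _ → refl
                ; sym   = λ f≈g xs → sym (f≈g xs)
                ; trans = λ f≈g g≈h xs → trans (f≈g xs) (g≈h xs)
                }
              ; ∙-cong = λ f≈g h≈k xs → cong₂ _⊕_ (f≈g xs) (h≈k xs)
              }
            ; assoc = λ f g h xs → A.assoc (fun f xs) (fun g xs) (fun h xs)
            }
          ; identity = (λ f xs → A.identityˡ (fun f xs)) , (λ f xs → A.identityʳ (fun f xs))
          }
        ; inverse = (λ f xs → A.inverseˡ (fun f xs)) , (λ f xs → A.inverseʳ (fun f xs))
        ; ⁻¹-cong = λ f≈g xs → cong ⊖_ (f≈g xs)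
        }
      ; comm = λ f g xs → A.comm (fun f xs) (fun g xs)
      }
    }
    where
    open DiscreteModule A
    module A = AbelianGroup abelianGroup

  infixr 8 _∗_

  _∗_ : ∀ {r A B} → ModuleHom A B → Cochain r A → Cochain r B
  _∗_ {r} φ f = mkCochain (ModuleHom.map φ ∘ fun f)
    (discrete-map₁ (G.topology ^ᵗ r) (ModuleHom.map φ) (continuous f))

  act-continuous : ∀ (A : DiscreteModule) {S : Setoid ℓ ℓ} (T : Topology S) {γ f} →
                   Continuous T G.topology γ → Continuous T (discrete ∣ A ∣) f →
                   Continuous T (discrete ∣ A ∣) (λ x → DiscreteModule._·_ A (γ x) (f x))
  act-continuous A T γ-cont f-cont =
    continuous-∘ T (G.topology ×ᵗ discrete ∣ A ∣) (discrete ∣ A ∣) (DiscreteModule.·-continuous A)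
      (×-continuous T G.topology (discrete ∣ A ∣) γ-cont f-cont)

  -- With i counted from zero, (x₁ , … , xᵢ₊₁ xᵢ₊₂ , … , xₙ₊₁).
  merge : ∀ {n} → Fin n → Vec G.Carrier (suc n) → Vec G.Carrier n
  merge zero    (x ∷ y ∷ xs) = x G.∙ y ∷ xs
  merge (suc i) (x ∷ xs)     = x ∷ merge i xs

  merge-continuous : ∀ {n} (i : Fin n) →
                     Continuous (G.topology ^ᵗ suc n) (G.topology ^ᵗ n) (merge i)
  merge-continuous {suc n} zero =
    continuous-≗ G² G¹ (λ { (_ ∷ _ ∷ _) → refl })
      (∷-continuous G.topology G² n
        (continuous-∘ G² (G.topology ×ᵗ G.topology) G.topology G.∙-continuous
          (×-continuous G² G.topology G.topology (head-continuous G.topology (suc n))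
            (continuous-∘ G² G¹ G.topology (head-continuous G.topology n) tail-cont)))
        (continuous-∘ G² G¹ (G.topology ^ᵗ n) (tail-continuous G.topology n) tail-cont))
    where
    G¹ = G.topology ^ᵗ suc n
    G² = G.topology ^ᵗ suc (suc n)
    tail-cont : Continuous G² G¹ tail
    tail-cont = tail-continuous G.topology (suc n)
  merge-continuous {suc n} (suc i) =
    continuous-≗ G² G¹ (λ { (_ ∷ _) → refl })
      (∷-continuous G.topology G² n (head-continuous G.topology (suc n))
        (continuous-∘ G² G¹ (G.topology ^ᵗ n) (merge-continuous i)
          (tail-continuous G.topology (suc n))))
    where
    G¹ = G.topology ^ᵗ suc n
    G² = G.topology ^ᵗ suc (suc n)

  module _ {A : DiscreteModule} where
    open DiscreteModule A

    coboundary : ∀ {r} → (Vec G.Carrier r → ∣ A ∣) → Vec G.Carrier (suc r) → ∣ A ∣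
    coboundary {r} f xs =
      head xs · f (tail xs)
      ⊕ sum (λ (i : Fin r) → sgn abelianGroup (suc (toℕ i)) (f (merge i xs)))
      ⊕ sgn abelianGroup (suc r) (f (init xs))

    d : ∀ {r} → Cochain r A → Cochain (suc r) A
    d {r} f = mkCochain (coboundary (fun f))
      (discrete-map₂ Gʳ⁺¹ _⊕_
        (discrete-map₂ Gʳ⁺¹ _⊕_
          (act-continuous A Gʳ⁺¹ (head-continuous G.topology r)
            (f∘-continuous (tail-continuous G.topology r)))
          (sum-continuous _ λ i → discrete-map₁ Gʳ⁺¹ (sgn abelianGroup (suc (toℕ i)))
            (f∘-continuous (merge-continuous i))))
        (discrete-map₁ Gʳ⁺¹ (sgn abelianGroup (suc r))
          (f∘-continuous (init-continuous G.topology r))))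
      where
      Gʳ⁺¹ = G.topology ^ᵗ suc r

      f∘-continuous : ∀ {h} → Continuous Gʳ⁺¹ (G.topology ^ᵗ r) h →
                      Continuous Gʳ⁺¹ (discrete ∣ A ∣) (fun f ∘ h)
      f∘-continuous = continuous-∘ Gʳ⁺¹ (G.topology ^ᵗ r) (discrete ∣ A ∣) (continuous f)

      sum-continuous : ∀ {n} (F : Fin n → Vec G.Carrier (suc r) → ∣ A ∣) →
                       (∀ i → Continuous Gʳ⁺¹ (discrete ∣ A ∣) (F i)) →
                       Continuous Gʳ⁺¹ (discrete ∣ A ∣) (λ xs → sum (λ i → F i xs))
      sum-continuous {zero}  F F-cont = constant-continuous Gʳ⁺¹ (discrete ∣ A ∣) 𝟘
      sum-continuous {suc n} F F-cont = discrete-map₂ Gʳ⁺¹ _⊕_ (F-cont zero)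
        (sum-continuous (F ∘ suc) (F-cont ∘ suc))

    d-+ : ∀ {r} (f g : Cochain r A) → d (f +ᶜ g) ≈ᶜ d f +ᶜ d g
    d-+ {r} f g xs = trans
      (cong₂ _⊕_
        (trans
          (cong₂ _⊕_ (·-distrib-⊕ _ _ _)
            (trans (sum-cong-≋ {r} λ i → sgn-∙ abelianGroup (suc (toℕ i)) _ _) (∑-distrib-+ {r} _ _)))
          (interchange _ _ _ _))
        (sgn-∙ abelianGroup (suc r) _ _))
      (interchange _ _ _ _)
      where
      open Sum (AbelianGroup.commutativeMonoid abelianGroup) using (sum-cong-≋; ∑-distrib-+)
      open CommutativeSemigroupProperties
        (AbelianGroup.commutativeSemigroup abelianGroup) using (interchange)

    d-cong : ∀ {r} {f g : Cochain r A} → f ≈ᶜ g → d f ≈ᶜ d g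
    d-cong {r} f≈g xs = cong₂ _⊕_
      (cong₂ _⊕_ (cong (head xs ·_) (f≈g _))
        (sum-cong-≋ {r} λ i → cong (sgn abelianGroup (suc (toℕ i))) (f≈g _)))
      (cong (sgn abelianGroup (suc r)) (f≈g _))
      where open Sum (AbelianGroup.commutativeMonoid abelianGroup) using (sum-cong-≋)

    d-0 : ∀ {r} → d {r} 0ᶜ ≈ᶜ 0ᶜ
    d-0 {r} = identityʳ-unique (d 0ᶜ) (d 0ᶜ)
      (AbelianGroup.trans C¹ {d 0ᶜ +ᶜ d 0ᶜ} {d (0ᶜ +ᶜ 0ᶜ)} {d 0ᶜ}
        (AbelianGroup.sym C¹ {d (0ᶜ +ᶜ 0ᶜ)} {d 0ᶜ +ᶜ d 0ᶜ} (d-+ 0ᶜ 0ᶜ))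
        (d-cong {f = 0ᶜ +ᶜ 0ᶜ} {0ᶜ} (AbelianGroup.identityˡ (cochainGroup r A) 0ᶜ)))
      where
      C¹ = cochainGroup (suc r) A
      open AbelianGroupProperties C¹ using (identityʳ-unique)

    d-neg : ∀ {r} (f : Cochain r A) → d (negᶜ f) ≈ᶜ negᶜ (d f)
    d-neg {r} f = inverseʳ-unique (d f) (d (negᶜ f)) λ xs →
      trans (sym (d-+ f (negᶜ f) xs))
        (trans (d-cong {f = f -ᶜ f} {0ᶜ} (AbelianGroup.inverseʳ (cochainGroup r A) f) xs) (d-0 {r} xs))
      where open AbelianGroupProperties (cochainGroup (suc r) A) using (inverseʳ-unique)

    IsCocycle : ∀ {r} → Cochain r A → Set ℓ
    IsCocycle f = d f ≈ᶜ 0ᶜ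

    -- C⁻¹ = 0, so the only coboundary in degree 0 is 0.
    IsCoboundary : ∀ {r} → Cochain r A → Set (lsuc ℓ)
    IsCoboundary {zero}  f = Lift (lsuc ℓ) (f ≈ᶜ 0ᶜ)
    IsCoboundary {suc r} f = ∃ λ (h : Cochain r A) → d h ≈ᶜ f

  H : ℕ → DiscreteModule → Setoid (lsuc ℓ) (lsuc ℓ)
  H r A = record
    { Carrier = Σ (Cochain r A) IsCocycle
    ; _≈_     = λ (f , _) (g , _) → IsCoboundary (f -ᶜ g)
    ; isEquivalence = record
      { refl  = λ {(f , _)} → reflᴴ r f
      ; sym   = λ {(f , _)} {(g , _)} → symᴴ r f g
      ; trans = λ {(f , _)} {(g , _)} {(h , _)} → transᴴ r f g h
      }
    }
    where
    open DiscreteModule A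
    open AbelianGroup abelianGroup using (inverseʳ; identityˡ; ∙-congʳ; ∙-congˡ; assoc; inverseˡ)
    open AbelianGroupProperties abelianGroup using (⁻¹-anti-homo‿-; ε⁻¹≈ε)

    telescope : ∀ a b c → (a ⊕ ⊖ b) ⊕ (b ⊕ ⊖ c) ≡ a ⊕ ⊖ c
    telescope a b c = trans (assoc _ _ _) (∙-congˡ
      (trans (sym (assoc _ _ _)) (trans (∙-congʳ (inverseˡ b)) (identityˡ _))))

    reflᴴ : ∀ r (f : Cochain r A) → IsCoboundary (f -ᶜ f)
    reflᴴ zero    f = lift λ xs → inverseʳ _
    reflᴴ (suc r) f = 0ᶜ , λ xs → trans (d-0 {A} {r} xs) (sym (inverseʳ _))

    symᴴ : ∀ r (f g : Cochain r A) → IsCoboundary (f -ᶜ g) → IsCoboundary (g -ᶜ f)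
    symᴴ zero f g (lift f-g≈0) = lift λ xs →
      trans (sym (⁻¹-anti-homo‿- _ _)) (trans (cong ⊖_ (f-g≈0 xs)) ε⁻¹≈ε)
    symᴴ (suc r) f g (h , dh≈) = negᶜ h , λ xs →
      trans (d-neg h xs) (trans (cong ⊖_ (dh≈ xs)) (⁻¹-anti-homo‿- _ _))

    transᴴ : ∀ r (f g h : Cochain r A) →
             IsCoboundary (f -ᶜ g) → IsCoboundary (g -ᶜ h) → IsCoboundary (f -ᶜ h)
    transᴴ zero f g h (lift f-g≈0) (lift g-h≈0) = lift λ xs →
      trans (sym (telescope _ (fun g xs) _))
        (trans (cong₂ _⊕_ (f-g≈0 xs) (g-h≈0 xs)) (identityˡ _))
    transᴴ (suc r) f g h (k , dk≈) (l , dl≈) = k +ᶜ l , λ xs →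
      trans (d-+ k l xs) (trans (cong₂ _⊕_ (dk≈ xs) (dl≈ xs)) (telescope _ _ _))

  Class : ℕ → DiscreteModule → Set (lsuc ℓ)
  Class r A = Setoid.Carrier (H r A)

  infix 4 _≈ᴴ_

  _≈ᴴ_ : ∀ {r A} → Class r A → Class r A → Set (lsuc ℓ)
  _≈ᴴ_ {r} {A} = Setoid._≈_ (H r A)

  -- f lifts α when j∗f is a cocycle representing α.
  Lifts : ∀ {r A′ A A″} → ShortExact A′ A A″ → Cochain r A → Class r A″ → Set (lsuc ℓ)
  Lifts E f α = Σ[ z ∈ IsCocycle (j ∗ f) ] (j ∗ f , z) ≈ᴴ α
    where open ShortExact E using (j)

  product-continuous : ∀ n → Continuous (G.topology ^ᵗ n) G.topology (foldr′ G._∙_ G.ε)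
  product-continuous zero = continuous-≗ (G.topology ^ᵗ 0) G.topology (λ { [] → refl })
    (constant-continuous (G.topology ^ᵗ 0) G.topology G.ε)
  product-continuous (suc n) = continuous-≗ Gⁿ⁺¹ G.topology (λ { (_ ∷ _) → refl })
    (continuous-∘ Gⁿ⁺¹ (G.topology ×ᵗ G.topology) G.topology G.∙-continuous
      (×-continuous Gⁿ⁺¹ G.topology G.topology (head-continuous G.topology n)
        (continuous-∘ Gⁿ⁺¹ (G.topology ^ᵗ n) G.topology (product-continuous n)
          (tail-continuous G.topology n))))
    where Gⁿ⁺¹ = G.topology ^ᵗ suc n

  cup : ∀ {A B C r s} → Bilinear A B C → Cochain r A → Cochain s B → Cochain (r + s) C
  cup {A} {B} {C} {r} {s} pairing f g = mkCochain
    (λ xs → fun f (take r xs) ⊠ (foldr′ G._∙_ G.ε (take r xs) · fun g (drop r xs)))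
    (discrete-map₂ Gʳ⁺ˢ _⊠_
      (continuous-∘ Gʳ⁺ˢ Gʳ (discrete ∣ A ∣) (continuous f) (take-continuous G.topology r s))
      (act-continuous B Gʳ⁺ˢ
        (continuous-∘ Gʳ⁺ˢ Gʳ G.topology (product-continuous r) (take-continuous G.topology r s))
        (continuous-∘ Gʳ⁺ˢ (G.topology ^ᵗ s) (discrete ∣ B ∣) (continuous g)
          (drop-continuous G.topology r s))))
    where
    open Bilinear pairing using (_⊠_)
    open DiscreteModule B using (_·_)
    Gʳ   = G.topology ^ᵗ r
    Gʳ⁺ˢ = G.topology ^ᵗ (r + s)

  module _ (T : TateProduct) where
    open TateProduct T

    -- f′ ∪ g + (-1)ʳ f ∪ g′, to be used when f′ and g′ are the coboundaries
    -- of f and g regarded as cochains in A′ and B′.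
    augmented : ∀ {r s} → Cochain r A → Cochain (suc r) A′ → Cochain s B → Cochain (suc s) B′ →
                Cochain (suc (r + s)) C
    augmented {r} {s} f f′ g g′ =
      cup pairing₁ f′ g
      +ᶜ sgn (cochainGroup (suc (r + s)) C) r
           (subst (λ n → Cochain n C) (+-suc r s) (cup pairing₂ f g′))

{-# OPTIONS --safe #-}
module Submission where

-- The proof rests on the Leibniz rule d (f ∪ g) = df ∪ g + (-1)ʳ f ∪ dg and on f′ ∪ ig′ = if′ ∪ g′,
-- the coincidence of the two pairings on A′ × B′.  Since if′ = df and ig′ = dg force df′ = 0 and
-- dg′ = 0, the coboundary of f′ ∪ g + (-1)ʳ f ∪ g′ is (-1)ʳ⁺¹ f′ ∪ ig′ + (-1)ʳ if′ ∪ g′ = 0.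
-- For independence of choices, bilinearity reduces to the case where jf or jg is a coboundary.
-- If jf is one, lifting its primitive to A gives f = t + i f₀ with t a coboundary; then f′ = df₀,
-- so f′ ∪ g + (-1)ʳ f ∪ g′ = (-1)ʳ t ∪ g′ + d (f₀ ∪ g), where t ∪ g′ is a coboundary because
-- dg′ = 0.  If jg is one, f′ ∪ g + (-1)ʳ f ∪ g′ = f′ ∪ t + d (f ∪ g₀) in the same way.

open import Defs
open import Algebra.Bundles using (AbelianGroup)
open import Algebra.Morphism.Structures using (IsGroupHomomorphism)
import Algebra.Properties.AbelianGroup as AbelianGroupProperties
import Algebra.Properties.CommutativeSemigroup as CommutativeSemigroupProperties
open import Data.Fin.Base using (Fin; zero; suc; toℕ)
open import Data.Nat.Base using (ℕ; zero; suc; _+_)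
open import Data.Nat.Properties using (+-suc)
open import Data.Product.Base using (Σ-syntax; ∃; _×_; _,_; proj₁; proj₂)
open import Data.Product.Relation.Binary.Pointwise.NonDependent using (×-setoid)
open import Data.Vec.Base using (Vec; []; _∷_; head; tail; init; take; drop; foldr′; cast)
open import Data.Vec.Properties using (cast-is-id)
open import Data.Vec.Relation.Binary.Pointwise.Inductive as Pointwise using (Pointwise; []; _∷_)
open import Function.Base using (_∘_)
open import Function.Bundles using (Func; module Equivalence)
open import Level using (Level; lift)
open import Relation.Binary.Bundles using (Setoid)
open import Relation.Binary.PropositionalEquality
  using (_≡_; _≗_; refl; sym; trans; cong; cong₂; subst; module ≡-Reasoning)

-- Iterated signs in an abelian group.

module _ {a b} (M : AbelianGroup a b) where
  open AbelianGroup M renaming (Carrier to ∣M∣; refl to ≈-refl; trans to ≈-trans; sym to ≈-sym)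
  open AbelianGroupProperties M using (ε⁻¹≈ε; ⁻¹-involutive)

  sgn-cong : ∀ n {x y} → x ≈ y → sgn M n x ≈ sgn M n y
  sgn-cong zero    x≈y = x≈y
  sgn-cong (suc n) x≈y = ⁻¹-cong (sgn-cong n x≈y)

  sgn-ε : ∀ n → sgn M n ε ≈ ε
  sgn-ε zero    = ≈-refl
  sgn-ε (suc n) = ≈-trans (⁻¹-cong (sgn-ε n)) ε⁻¹≈ε

  sgn-⁻¹ : ∀ n x → sgn M n (x ⁻¹) ≈ sgn M n x ⁻¹
  sgn-⁻¹ zero    x = ≈-refl
  sgn-⁻¹ (suc n) x = ⁻¹-cong (sgn-⁻¹ n x)

  sgn-involutive : ∀ n x → sgn M n (sgn M n x) ≈ x
  sgn-involutive zero    x = ≈-refl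
  sgn-involutive (suc n) x =
    ≈-trans (⁻¹-cong (sgn-⁻¹ n (sgn M n x))) (≈-trans (⁻¹-involutive _) (sgn-involutive n x))

module CochainProducts {ℓ : Level} (G : TopologicalGroup ℓ) where
  private module G = TopologicalGroup G
  private module Copy = ContinuousCohomology G
  open Copy hiding (d; cup; augmented; _∗_; negᶜ; _+ᶜ_; _-ᶜ_)
  open Cochain

  -- Agda unfolds copies made by a module application in the arguments of terms but not in types,
  -- and would then have to compare continuity proofs of cochains; ordinary definitions are immune.
  d : ∀ {A r} → Cochain r A → Cochain (suc r) A
  d = Copy.d

  cup : ∀ {A B C r s} → Bilinear A B C → Cochain r A → Cochain s B → Cochain (r + s) C
  cup = Copy.cup

  infixr 8 _∗_
  _∗_ : ∀ {A B r} → ModuleHom A B → Cochain r A → Cochain r B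
  _∗_ = Copy._∗_

  infixl 6 _+ᶜ_ _-ᶜ_
  _+ᶜ_ _-ᶜ_ : ∀ {A r} → Cochain r A → Cochain r A → Cochain r A
  _+ᶜ_ = Copy._+ᶜ_
  _-ᶜ_ = Copy._-ᶜ_

  negᶜ : ∀ {A r} → Cochain r A → Cochain r A
  negᶜ = Copy.negᶜ

  sgnᶜ : ∀ {A r} → ℕ → Cochain r A → Cochain r A
  sgnᶜ {A} {r} = sgn (cochainGroup r A)

  augmented : (T : TateProduct) (let open TateProduct T) → ∀ {r s} →
              Cochain r A → Cochain (suc r) A′ → Cochain s B → Cochain (suc s) B′ →
              Cochain (suc (r + s)) C
  augmented = Copy.augmented

  private
    module Ab (A : DiscreteModule) where
      open AbelianGroup (DiscreteModule.abelianGroup A) public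
        using (assoc; identityˡ; identityʳ; inverseˡ; inverseʳ)
      open AbelianGroupProperties (DiscreteModule.abelianGroup A) public
      open CommutativeSemigroupProperties
        (AbelianGroup.commutativeSemigroup (DiscreteModule.abelianGroup A)) public
        using (interchange; x∙yz≈y∙xz)

  -- Additive maps between modules.

  module _ (A B : DiscreteModule) where
    private
      module A = DiscreteModule A
      module B = DiscreteModule B

    -- Wide enough to cover the action of a single group element, negation and a pairing with one
    -- argument fixed, besides the maps underlying module homomorphisms.
    Additive : (∣ A ∣ → ∣ B ∣) → Set ℓ
    Additive φ = ∀ a b → φ (a A.⊕ b) ≡ φ a B.⊕ φ b

    module _ {φ : ∣ A ∣ → ∣ B ∣} (φ-⊕ : Additive φ) where

      additive-𝟘 : φ A.𝟘 ≡ B.𝟘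
      additive-𝟘 = Ab.identityʳ-unique B (φ A.𝟘) (φ A.𝟘)
        (trans (sym (φ-⊕ _ _)) (cong φ (Ab.identityˡ A A.𝟘)))

      additive-⊖ : ∀ a → φ (A.⊖ a) ≡ B.⊖ φ a
      additive-⊖ a = Ab.inverseʳ-unique B (φ a) (φ (A.⊖ a))
        (trans (sym (φ-⊕ _ _)) (trans (cong φ (Ab.inverseʳ A a)) additive-𝟘))

  -- The coboundary in recursive form.

  module _ (A : DiscreteModule) where
    open DiscreteModule A
    open Ab A

    -- All of d f but its first term; this is the part that has a recursion in r.
    ∂ : ∀ {r} → (Vec G.Carrier r → ∣ A ∣) → Vec G.Carrier (suc r) → ∣ A ∣
    ∂ {zero}  f (x ∷ [])     = ⊖ f []
    ∂ {suc r} f (x ∷ y ∷ xs) = ⊖ (f (x G.∙ y ∷ xs) ⊕ ∂ (f ∘ (x ∷_)) (y ∷ xs))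

    sum-⊖ : ∀ {n} (t : Fin n → ∣ A ∣) → sum (⊖_ ∘ t) ≡ ⊖ sum t
    sum-⊖ {zero}  t = sym ε⁻¹≈ε
    sum-⊖ {suc n} t = trans (cong (⊖ t zero ⊕_) (sum-⊖ (t ∘ suc))) (⁻¹-∙-comm _ _)

    -- Induction on `r`: once the term with `x ∙ y` is split off, what remains is the same
    -- expression for `f ∘ (x ∷_)` with every sign reversed, since each index has moved by one.
    sum-merge≡∂ : ∀ {r} (f : Vec G.Carrier r → ∣ A ∣) xs →
      sum (λ (i : Fin r) → sgn abelianGroup (suc (toℕ i)) (f (merge i xs)))
        ⊕ sgn abelianGroup (suc r) (f (init xs)) ≡ ∂ f xs
    sum-merge≡∂ {zero}  f (x ∷ [])     = identityˡ _
    sum-merge≡∂ {suc r} f (x ∷ y ∷ xs) = begin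
      (⊖ a ⊕ sum (⊖_ ∘ t)) ⊕ ⊖ b  ≡⟨ assoc _ _ _ ⟩
      ⊖ a ⊕ (sum (⊖_ ∘ t) ⊕ ⊖ b)  ≡⟨ cong (λ z → ⊖ a ⊕ (z ⊕ ⊖ b)) (sum-⊖ t) ⟩
      ⊖ a ⊕ (⊖ sum t ⊕ ⊖ b)       ≡⟨ cong (⊖ a ⊕_) (⁻¹-∙-comm _ _) ⟩
      ⊖ a ⊕ ⊖ (sum t ⊕ b)         ≡⟨ ⁻¹-∙-comm _ _ ⟩
      ⊖ (a ⊕ (sum t ⊕ b))         ≡⟨ cong (λ z → ⊖ (a ⊕ z)) (sum-merge≡∂ (f ∘ (x ∷_)) (y ∷ xs)) ⟩
      ⊖ (a ⊕ ∂ (f ∘ (x ∷_)) (y ∷ xs)) ∎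
      where
      open ≡-Reasoning
      a = f (x G.∙ y ∷ xs)
      b = sgn abelianGroup (suc r) (f (x ∷ init (y ∷ xs)))
      t : Fin r → ∣ A ∣
      t i = sgn abelianGroup (suc (toℕ i)) (f (x ∷ merge i (y ∷ xs)))

    coboundary≡∂ : ∀ {r} (f : Vec G.Carrier r → ∣ A ∣) xs →
      coboundary {A} f xs ≡ head xs · f (tail xs) ⊕ ∂ f xs
    coboundary≡∂ f xs = trans (assoc _ _ _) (cong (head xs · f (tail xs) ⊕_) (sum-merge≡∂ f xs))

    ∂-cong : ∀ {r} {f g : Vec G.Carrier r → ∣ A ∣} → f ≗ g → ∂ f ≗ ∂ g
    ∂-cong {zero}  f≗g (x ∷ [])     = cong ⊖_ (f≗g [])
    ∂-cong {suc r} f≗g (x ∷ y ∷ xs) =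
      cong ⊖_ (cong₂ _⊕_ (f≗g _) (∂-cong (f≗g ∘ (x ∷_)) (y ∷ xs)))

    ∂-⊕ : ∀ {r} (f g : Vec G.Carrier r → ∣ A ∣) xs → ∂ (λ ws → f ws ⊕ g ws) xs ≡ ∂ f xs ⊕ ∂ g xs
    ∂-⊕ {zero}  f g (x ∷ [])     = sym (⁻¹-∙-comm _ _)
    ∂-⊕ {suc r} f g (x ∷ y ∷ xs) = trans
      (cong ⊖_ (trans (cong (_ ⊕_) (∂-⊕ (f ∘ (x ∷_)) (g ∘ (x ∷_)) (y ∷ xs))) (interchange _ _ _ _)))
      (sym (⁻¹-∙-comm _ _))

  -- `∂` consists of merges, sums and signs; the group acts only in the first term of the
  -- coboundary, which `∂` omits. Hence additivity of `φ` suffices.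
  ∂-additive : ∀ (A B : DiscreteModule) {φ} → Additive A B φ →
               ∀ {r} (f : Vec G.Carrier r → ∣ A ∣) xs → φ (∂ A f xs) ≡ ∂ B (φ ∘ f) xs
  ∂-additive A B φ-⊕ {zero}  f (x ∷ [])     = additive-⊖ A B φ-⊕ _
  ∂-additive A B φ-⊕ {suc r} f (x ∷ y ∷ xs) = trans (additive-⊖ A B φ-⊕ _)
    (cong (DiscreteModule.⊖_ B) (trans (φ-⊕ _ _)
      (cong (DiscreteModule._⊕_ B _) (∂-additive A B φ-⊕ (f ∘ (x ∷_)) (y ∷ xs)))))

  -- The coboundary squares to zero.

  module _ (A : DiscreteModule) where
    open DiscreteModule A
    open Ab A

    -- Unfolding both copies of `∂` once leaves three terms: `∂ f` at `x ∙ y`, `∂ f∙`, and the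
    -- double `∂` of `f ∘ (x ∷_)`. The last vanishes by induction, and the first two cancel by
    -- associativity in the group. That law holds only up to `G._≈_`, so `f` has to respect this
    -- relation.
    ∂-∂ : ∀ {r} (f : Vec G.Carrier r → ∣ A ∣) →
          (∀ {xs ys} → Pointwise G._≈_ xs ys → f xs ≡ f ys) →
          ∀ xs → ∂ A (∂ A f) xs ≡ 𝟘
    ∂-∂ {zero}  f f-cong (x ∷ y ∷ [])     = trans (cong ⊖_ (inverseʳ _)) ε⁻¹≈ε
    ∂-∂ {suc r} f f-cong (x ∷ y ∷ z ∷ zs) = begin
      ⊖ (a ⊕ ∂ A (∂ A f ∘ (x ∷_)) (y ∷ z ∷ zs))
        ≡⟨ cong (λ t → ⊖ (a ⊕ t)) (∂-cong A unfold (y ∷ z ∷ zs)) ⟩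
      ⊖ (a ⊕ ∂ A (λ ws → ⊖ (f∙ ws ⊕ ∂ A (f ∘ (x ∷_)) ws)) (y ∷ z ∷ zs))
        ≡⟨ cong (λ t → ⊖ (a ⊕ t))
             (∂-additive A A {⊖_} (λ a b → sym (⁻¹-∙-comm a b))
               (λ ws → f∙ ws ⊕ ∂ A (f ∘ (x ∷_)) ws) (y ∷ z ∷ zs)) ⟨
      ⊖ (a ⊕ ⊖ ∂ A (λ ws → f∙ ws ⊕ ∂ A (f ∘ (x ∷_)) ws) (y ∷ z ∷ zs))
        ≡⟨ cong (λ t → ⊖ (a ⊕ ⊖ t)) (∂-⊕ A f∙ (∂ A (f ∘ (x ∷_))) (y ∷ z ∷ zs)) ⟩
      ⊖ (a ⊕ ⊖ (∂ A f∙ (y ∷ z ∷ zs) ⊕ ∂ A (∂ A (f ∘ (x ∷_))) (y ∷ z ∷ zs)))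
        ≡⟨ cong (λ t → ⊖ (a ⊕ ⊖ t)) (cong₂ _⊕_ f∙-assoc
             (∂-∂ (f ∘ (x ∷_)) (λ p → f-cong (G.refl ∷ p)) (y ∷ z ∷ zs))) ⟩
      ⊖ (a ⊕ ⊖ (a ⊕ 𝟘))
        ≡⟨ cong (λ t → ⊖ (a ⊕ ⊖ t)) (identityʳ a) ⟩
      ⊖ (a ⊕ ⊖ a)
        ≡⟨ trans (cong ⊖_ (inverseʳ a)) ε⁻¹≈ε ⟩
      𝟘 ∎
      where
      open ≡-Reasoning
      a = ∂ A f (x G.∙ y ∷ z ∷ zs)
      f∙ : Vec G.Carrier (suc r) → ∣ A ∣
      f∙ ws = f (x G.∙ head ws ∷ tail ws)
      -- The recursive clause of `∂` applies only to a visible second entry, hence the case split on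
      -- `ws`.
      unfold : ∀ ws → ∂ A f (x ∷ ws) ≡ ⊖ (f∙ ws ⊕ ∂ A (f ∘ (x ∷_)) ws)
      unfold (w ∷ ws) = refl
      f∙-assoc : ∂ A f∙ (y ∷ z ∷ zs) ≡ a
      f∙-assoc = cong (λ t → ⊖ (t ⊕ ∂ A (f ∘ (x G.∙ y ∷_)) (z ∷ zs)))
        (f-cong (G.sym (G.assoc x y z) ∷ Pointwise.refl G.refl))

    -- With the first term of each coboundary split off, `x · ∂ f` equals `∂` of `(x ·_) ∘ f`
    -- because `x ·_` is additive. It therefore cancels against the merges of the outer coboundary,
    -- and only `∂ (∂ f)` is left over.
    d-d : ∀ {r} (f : Cochain r A) → IsCocycle (d f)
    d-d f (x ∷ y ∷ zs) = begin
      coboundary {A} (fun (d f)) (x ∷ y ∷ zs)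
        ≡⟨ coboundary≡∂ A (fun (d f)) (x ∷ y ∷ zs) ⟩
      x · fun (d f) (y ∷ zs) ⊕ ∂ A (fun (d f)) (x ∷ y ∷ zs)
        ≡⟨ cong₂ _⊕_ (cong (x ·_) (coboundary≡∂ A (fun f) (y ∷ zs)))
             (trans (∂-cong A (coboundary≡∂ A (fun f)) (x ∷ y ∷ zs))
                  (∂-⊕ A (λ ws → head ws · fun f (tail ws)) (∂ A (fun f)) (x ∷ y ∷ zs))) ⟩
      x · (y · fun f zs ⊕ ∂ A (fun f) (y ∷ zs))
        ⊕ (⊖ ((x G.∙ y) · fun f zs ⊕ ∂ A ((x ·_) ∘ fun f) (y ∷ zs))
           ⊕ ∂ A (∂ A (fun f)) (x ∷ y ∷ zs))
        ≡⟨ cong₂ (λ s t → x · (y · fun f zs ⊕ ∂ A (fun f) (y ∷ zs)) ⊕ (⊖ s ⊕ t))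
             (cong₂ _⊕_ (·-assoc x y _) (sym (∂-additive A A (·-distrib-⊕ x) (fun f) (y ∷ zs))))
             (∂-∂ (fun f) (fun-cong f) (x ∷ y ∷ zs)) ⟩
      x · (y · fun f zs ⊕ ∂ A (fun f) (y ∷ zs))
        ⊕ (⊖ (x · (y · fun f zs) ⊕ x · ∂ A (fun f) (y ∷ zs)) ⊕ 𝟘)
        ≡⟨ cong₂ _⊕_ (·-distrib-⊕ x _ _) (identityʳ _) ⟩
      (x · (y · fun f zs) ⊕ x · ∂ A (fun f) (y ∷ zs))
        ⊕ ⊖ (x · (y · fun f zs) ⊕ x · ∂ A (fun f) (y ∷ zs))
        ≡⟨ inverseʳ _ ⟩
      𝟘 ∎
      where open ≡-Reasoning

  -- Transport along a nontrivial equation of degrees does not compute, whereas `cast` does on a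
  -- cons; so the transport is moved from the cochain to its argument.
  fun-subst : ∀ {A m n} (p : m ≡ n) (c : Cochain m A) xs →
              fun (subst (λ k → Cochain k A) p c) xs ≡ fun c (cast (sym p) xs)
  fun-subst refl c xs = cong (fun c) (sym (cast-is-id refl xs))

  -- The Leibniz rule for cup products.

  module _ {A B C : DiscreteModule} (pairing : Bilinear A B C) where
    open Bilinear pairing
    private
      module A = DiscreteModule A
      module B = DiscreteModule B
      module C = DiscreteModule C

    ⊠-additiveˡ : ∀ b → Additive A C (_⊠ b)
    ⊠-additiveˡ b a a₁ = distribʳ a a₁ b

    ⊠-additiveʳ : ∀ a → Additive B C (a ⊠_)
    ⊠-additiveʳ = distribˡ

    -- The twist h is what makes the cup product recursive in r: fixing the
    -- first argument x of f replaces h by h ∘ (x ·_).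
    twistedCup : (∣ B ∣ → ∣ B ∣) → ∀ {r s} →
                 (Vec G.Carrier r → ∣ A ∣) → (Vec G.Carrier s → ∣ B ∣) →
                 Vec G.Carrier (r + s) → ∣ C ∣
    twistedCup h {r} f g xs =
      f (take r xs) ⊠ h (foldr′ G._∙_ G.ε (take r xs) B.· g (drop r xs))

    twistedCup-∷ : ∀ h {r s}
      (f : Vec G.Carrier (suc r) → ∣ A ∣) (g : Vec G.Carrier s → ∣ B ∣) x xs →
      twistedCup h f g (x ∷ xs) ≡ twistedCup (h ∘ (x B.·_)) (f ∘ (x ∷_)) g xs
    twistedCup-∷ h {r} f g x xs = cong (λ b → f (x ∷ take r xs) ⊠ h b) (B.·-assoc _ _ _)

    -- The Leibniz rule without its first term, by induction on `r`. The asymmetry between `∂` of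
    -- `f` and the full coboundary of `g` is forced: the last term of `∂ f`, in which `f` drops its
    -- last argument, cancels the first term of the coboundary of `g`, in which that argument acts.
    ∂-twistedCup : ∀ {h} → Additive B B h → ∀ {r s}
      (f : Vec G.Carrier r → ∣ A ∣) (g : Vec G.Carrier s → ∣ B ∣) xs →
      ∂ C (twistedCup h f g) xs ≡
        twistedCup h (∂ A f) g xs
          C.⊕ sgn C.abelianGroup r
                (twistedCup h f (coboundary {B} g) (cast (sym (+-suc r s)) xs))
    ∂-twistedCup {h} h-⊕ {zero} f g (x ∷ xs) = begin
      ∂ C (λ ws → f [] ⊠ h (G.ε B.· g ws)) (x ∷ xs)
        ≡⟨ ∂-cong C (λ ws → cong (λ b → f [] ⊠ h b) (B.·-identity (g ws))) (x ∷ xs) ⟩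
      ∂ C (λ ws → f [] ⊠ h (g ws)) (x ∷ xs)
        ≡⟨ ∂-additive B C {λ b → f [] ⊠ h b}
             (λ b b₁ → trans (cong (f [] ⊠_) (h-⊕ b b₁)) (distribˡ _ _ _)) g (x ∷ xs) ⟨
      v
        ≡⟨ \\-leftDividesʳ u v ⟨
      -- The inserted `⊖ u` becomes the `∂ f` term, while `u ⊕ v` assembles the full coboundary of
      -- `g`.
      C.⊖ u C.⊕ (u C.⊕ v)
        ≡⟨ cong₂ C._⊕_ (sym (additive-⊖ A C (⊠-additiveˡ _) (f [])))
             (trans (sym (distribˡ _ _ _)) (cong (f [] ⊠_) (sym (h-⊕ _ _)))) ⟩
      (A.⊖ f []) ⊠ h (x B.· g xs) C.⊕ f [] ⊠ h (x B.· g xs B.⊕ ∂ B g (x ∷ xs))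
        ≡⟨ cong₂ (λ b b₁ → (A.⊖ f []) ⊠ h b C.⊕ f [] ⊠ h b₁)
             (sym (trans (B.·-assoc _ _ _) (cong (x B.·_) (B.·-identity _))))
             (trans (sym (coboundary≡∂ B g (x ∷ xs)))
               (trans (cong (coboundary {B} g) (sym (cast-is-id refl (x ∷ xs))))
                 (sym (B.·-identity _)))) ⟩
      (A.⊖ f []) ⊠ h ((x G.∙ G.ε) B.· g xs)
        C.⊕ f [] ⊠ h (G.ε B.· coboundary {B} g (cast refl (x ∷ xs))) ∎
      where
      open ≡-Reasoning
      open Ab C using (\\-leftDividesʳ)
      u = f [] ⊠ h (x B.· g xs)
      v = f [] ⊠ h (∂ B g (x ∷ xs))
    ∂-twistedCup {h} h-⊕ {suc r} {s} f g (x ∷ y ∷ xs) = begin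
      C.⊖ (twistedCup h f g (x G.∙ y ∷ xs) C.⊕ ∂ C (twistedCup h f g ∘ (x ∷_)) (y ∷ xs))
        ≡⟨ cong₂ (λ c c₁ → C.⊖ (c C.⊕ c₁))
             -- Reassociating the product that starts with `x ∙ y` gives this term the same right
             -- factor `b` as the one from the induction hypothesis, so that `distribʳ` can merge
             -- them into a value of `∂ f`.
             (cong (λ b → a ⊠ h b) (trans (B.·-assoc _ _ _) (trans (B.·-assoc _ _ _)
               (cong (x B.·_) (sym (B.·-assoc _ _ _))))))
             (trans (∂-cong C (twistedCup-∷ h f g x) (y ∷ xs))
               (∂-twistedCup hx-⊕ fx g (y ∷ xs))) ⟩
      C.⊖ (a ⊠ h b C.⊕ (a₁ ⊠ h b C.⊕ w))
        ≡⟨ cong C.⊖_ (sym (assoc _ _ _)) ⟩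
      C.⊖ (a ⊠ h b C.⊕ a₁ ⊠ h b C.⊕ w)
        ≡⟨ cong (λ c → C.⊖ (c C.⊕ w)) (sym (distribʳ a a₁ (h b))) ⟩
      C.⊖ ((a A.⊕ a₁) ⊠ h b C.⊕ w)
        ≡⟨ ⁻¹-∙-comm _ _ ⟨
      C.⊖ ((a A.⊕ a₁) ⊠ h b) C.⊕ C.⊖ w
        ≡⟨ cong₂ C._⊕_
             (trans (sym (additive-⊖ A C (⊠-additiveˡ _) _))
               (cong (λ b → (A.⊖ (a A.⊕ a₁)) ⊠ h b) (sym (B.·-assoc _ _ _))))
             (cong (λ c → C.⊖ sgn C.abelianGroup r c)
               (sym (twistedCup-∷ h f (coboundary {B} g) x (cast (sym (+-suc r s)) (y ∷ xs))))) ⟩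
      twistedCup h (∂ A f) g (x ∷ y ∷ xs)
        C.⊕ sgn C.abelianGroup (suc r)
              (twistedCup h f (coboundary {B} g) (x ∷ cast (sym (+-suc r s)) (y ∷ xs))) ∎
      where
      open ≡-Reasoning
      open Ab C using (assoc; ⁻¹-∙-comm)
      fx = f ∘ (x ∷_)
      a  = f (x G.∙ y ∷ take r xs)
      a₁ = ∂ A fx (y ∷ take r xs)
      b  = x B.· (foldr′ G._∙_ G.ε (y ∷ take r xs) B.· g (drop r xs))
      w  = sgn C.abelianGroup r
             (twistedCup (h ∘ (x B.·_)) fx (coboundary {B} g) (cast (sym (+-suc r s)) (y ∷ xs)))
      hx-⊕ : Additive B B (h ∘ (x B.·_))
      hx-⊕ b b₁ = trans (cong h (B.·-distrib-⊕ x b b₁)) (h-⊕ _ _)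

    -- Transported to the degree of the other term of the Leibniz rule.
    cup⁺ : ∀ {r s} → Cochain r A → Cochain (suc s) B → Cochain (suc (r + s)) C
    cup⁺ {r} {s} f g = subst (λ n → Cochain n C) (+-suc r s) (cup pairing f g)

    -- Equivariance of the pairing turns the leading term of the coboundary into the leading term of
    -- `d f` paired with the translate of `g`; the remaining terms are `∂-twistedCup` with the
    -- identity as twist.
    d-cup : ∀ {r s} (f : Cochain r A) (g : Cochain s B) xs →
      fun (d (cup pairing f g)) xs ≡
        fun (cup pairing (d f) g) xs C.⊕ sgn C.abelianGroup r (fun (cup⁺ f (d g)) xs)
    d-cup {r} {s} f g (x ∷ xs) = begin
      fun (d (cup pairing f g)) (x ∷ xs)
        ≡⟨ coboundary≡∂ C (fun (cup pairing f g)) (x ∷ xs) ⟩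
      x C.· (a ⊠ b) C.⊕ ∂ C (fun (cup pairing f g)) (x ∷ xs)
        ≡⟨ cong₂ C._⊕_
             (trans (equivariant x a b) (cong ((x A.· a) ⊠_) (sym (B.·-assoc _ _ _))))
             (∂-twistedCup {λ b → b} (λ _ _ → refl) (fun f) (fun g) (x ∷ xs)) ⟩
      (x A.· a) ⊠ b₁ C.⊕ (a₁ ⊠ b₁ C.⊕ w)
        ≡⟨ assoc _ _ _ ⟨
      (x A.· a) ⊠ b₁ C.⊕ a₁ ⊠ b₁ C.⊕ w
        ≡⟨ cong₂ C._⊕_
             (trans (sym (distribʳ _ _ _))
               (cong (_⊠ b₁) (sym (coboundary≡∂ A (fun f) (x ∷ take r xs)))))
             (cong (sgn C.abelianGroup r) (sym
               (fun-subst (+-suc r s) (cup pairing f (d g)) (x ∷ xs)))) ⟩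
      fun (cup pairing (d f) g) (x ∷ xs)
        C.⊕ sgn C.abelianGroup r (fun (cup⁺ f (d g)) (x ∷ xs)) ∎
      where
      open ≡-Reasoning
      open Ab C using (assoc)
      a  = fun f (take r xs)
      a₁ = ∂ A (fun f) (x ∷ take r xs)
      b  = foldr′ G._∙_ G.ε (take r xs) B.· fun g (drop r xs)
      b₁ = foldr′ G._∙_ G.ε (x ∷ take r xs) B.· fun g (drop r xs)
      w  = sgn C.abelianGroup r (fun (cup pairing f (d g)) (cast (sym (+-suc r s)) (x ∷ xs)))

  -- Signs, transport of degrees and coboundaries.

  module _ {A : DiscreteModule} where
    open DiscreteModule A
    open Ab A

    fun-sgn : ∀ k {n} (f : Cochain n A) xs →
              fun (sgnᶜ k f) xs ≡ sgn abelianGroup k (fun f xs)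
    fun-sgn zero    f xs = refl
    fun-sgn (suc k) f xs = cong ⊖_ (fun-sgn k f xs)

    d-sgn : ∀ k {n} (f : Cochain n A) →
            d (sgnᶜ k f) ≈ᶜ sgnᶜ k (d f)
    d-sgn zero        f xs = refl
    d-sgn (suc k) {n} f xs =
      trans (d-neg (sgnᶜ k f) xs) (cong ⊖_ (d-sgn k f xs))

    d-minus : ∀ {n} (f g : Cochain n A) → d (f -ᶜ g) ≈ᶜ d f -ᶜ d g
    d-minus f g xs = trans (d-+ f (negᶜ g) xs) (cong (fun (d f) xs ⊕_) (d-neg g xs))

    subst-congᶜ : ∀ {m n} (p : m ≡ n) (f g : Cochain m A) → f ≈ᶜ g →
      subst (λ k → Cochain k A) p f ≈ᶜ subst (λ k → Cochain k A) p g
    subst-congᶜ refl f g f≈g = f≈g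

    d-subst : ∀ {m n} (p : m ≡ n) (f : Cochain m A) →
      d (subst (λ k → Cochain k A) p f) ≈ᶜ subst (λ k → Cochain k A) (cong suc p) (d f)
    d-subst refl f xs = refl

    coboundary-≈ : ∀ {n} (f g : Cochain n A) → f ≈ᶜ g → IsCoboundary f → IsCoboundary g
    coboundary-≈ {zero}  f g f≈g (lift f≈0) = lift λ xs → trans (sym (f≈g xs)) (f≈0 xs)
    coboundary-≈ {suc n} f g f≈g (h , dh≈f) = h , λ xs → trans (dh≈f xs) (f≈g xs)

    coboundary-0 : ∀ {n} (f : Cochain n A) → f ≈ᶜ 0ᶜ → IsCoboundary f
    coboundary-0 {zero}  f f≈0 = lift f≈0
    coboundary-0 {suc n} f f≈0 = 0ᶜ , λ xs → trans (d-0 {A} {n} xs) (sym (f≈0 xs))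

    coboundary-+ : ∀ {n} (f g : Cochain n A) →
                   IsCoboundary f → IsCoboundary g → IsCoboundary (f +ᶜ g)
    coboundary-+ {zero}  f g (lift f≈0) (lift g≈0) =
      lift λ xs → trans (cong₂ _⊕_ (f≈0 xs) (g≈0 xs)) (identityˡ 𝟘)
    coboundary-+ {suc n} f g (h , dh≈f) (k , dk≈g) =
      h +ᶜ k , λ xs → trans (d-+ h k xs) (cong₂ _⊕_ (dh≈f xs) (dk≈g xs))

    coboundary-sgn : ∀ k {n} (f : Cochain (suc n) A) →
                     IsCoboundary f → IsCoboundary (sgnᶜ k f)
    coboundary-sgn k {n} f (h , dh≈f) = sgnᶜ k h , λ xs →
      trans (d-sgn k h xs) (sgn-cong (cochainGroup (suc n) A) k {d h} {f} dh≈f xs)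

    coboundary-subst⁻ : ∀ {m n} (p : m ≡ n) (f : Cochain (suc m) A) →
      IsCoboundary (subst (λ k → Cochain k A) (cong suc p) f) → IsCoboundary f
    coboundary-subst⁻ refl f f-cob = f-cob

    coboundary⇒cocycle : ∀ {n} (f : Cochain n A) → IsCoboundary f → IsCocycle f
    coboundary⇒cocycle {zero}  f (lift f≈0) xs = trans (d-cong {f = f} {0ᶜ} f≈0 xs) (d-0 {A} xs)
    coboundary⇒cocycle {suc n} f (h , dh≈f) xs =
      trans (d-cong {f = f} {d h} (λ ys → sym (dh≈f ys)) xs) (d-d A h xs)

  -- Functoriality of cochains in the module.

  module _ {A B : DiscreteModule} (φ : ModuleHom A B) where
    private
      module A = DiscreteModule A
      module B = DiscreteModule B
    open ModuleHom φ
    open IsGroupHomomorphism isGroupHom using (homo; ⁻¹-homo)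

    ∗-d : ∀ {r} (f : Cochain r A) → φ ∗ d f ≈ᶜ d (φ ∗ f)
    ∗-d f xs = begin
      map (coboundary {A} (fun f) xs)
        ≡⟨ cong map (coboundary≡∂ A (fun f) xs) ⟩
      map (head xs A.· fun f (tail xs) A.⊕ ∂ A (fun f) xs)
        ≡⟨ homo _ _ ⟩
      map (head xs A.· fun f (tail xs)) B.⊕ map (∂ A (fun f) xs)
        ≡⟨ cong₂ B._⊕_ (equivariant _ _) (∂-additive A B homo (fun f) xs) ⟩
      head xs B.· map (fun f (tail xs)) B.⊕ ∂ B (map ∘ fun f) xs
        ≡⟨ coboundary≡∂ B (map ∘ fun f) xs ⟨
      coboundary {B} (map ∘ fun f) xs ∎
      where open ≡-Reasoning

    ∗-minus : ∀ {r} (f g : Cochain r A) → φ ∗ (f -ᶜ g) ≈ᶜ φ ∗ f -ᶜ φ ∗ g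
    ∗-minus f g xs = trans (homo _ _) (cong (map (fun f xs) B.⊕_) (⁻¹-homo _))

  -- Cochains along a short exact sequence.

  module _ {A′ A A″ : DiscreteModule} (E : ShortExact A′ A A″) where
    private
      module A′ = DiscreteModule A′
      module A = DiscreteModule A
      module A″ = DiscreteModule A″
    open ShortExact E
    private
      module i = ModuleHom i
      module j = ModuleHom j

    ∗-injective : ∀ {r} (f g : Cochain r A′) → i ∗ f ≈ᶜ i ∗ g → f ≈ᶜ g
    ∗-injective f g if≈ig xs = injective (if≈ig xs)

    -- The choice of preimages under `j` is in general neither additive nor equivariant, but any map
    -- out of a discrete space is continuous.
    liftCochain : ∀ {r} (f″ : Cochain r A″) → Σ[ f ∈ Cochain r A ] j ∗ f ≈ᶜ f″
    liftCochain {r} f″ =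
      mkCochain (proj₁ ∘ surjective ∘ fun f″)
        (discrete-map₁ (G.topology ^ᵗ r) (proj₁ ∘ surjective) (continuous f″)) ,
      λ xs → proj₂ (surjective (fun f″ xs))

    kernelCochain : ∀ {r} (f : Cochain r A) → j ∗ f ≈ᶜ 0ᶜ → Σ[ f′ ∈ Cochain r A′ ] i ∗ f′ ≈ᶜ f
    kernelCochain {r} f jf≈0 = mkCochain (proj₁ ∘ preimage) preimage-continuous , proj₂ ∘ preimage
      where
      preimage : ∀ xs → ∃ λ a′ → i.map a′ ≡ fun f xs
      preimage xs = Equivalence.to (exact (fun f xs)) (jf≈0 xs)

      preimage-continuous : Continuous (G.topology ^ᵗ r) (discrete ∣ A′ ∣) (proj₁ ∘ preimage)
      -- The preimage is chosen through a membership proof at each `xs`, not by a map defined on all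
      -- of `A`. Since `i` is injective, the inverse image of `V` is the inverse image under `f` of
      -- the image of `V` in `A`, which is open as `A` is discrete.
      preimage-continuous V _ = Topology.Open-≐ (G.topology ^ᵗ r)
        ( (λ { {xs} (a′ , a′∈V , ia′≡) →
               subst V (injective (trans ia′≡ (sym (proj₂ (preimage xs))))) a′∈V })
        , (λ {xs} a′∈V → proj₁ (preimage xs) , a′∈V , proj₂ (preimage xs)) )
        (continuous f (λ a → ∃ λ a′ → V a′ × i.map a′ ≡ a) _)

    d-kernel : ∀ {r} (f : Cochain r A) → IsCocycle (j ∗ f) →
               Σ[ f′ ∈ Cochain (suc r) A′ ] i ∗ f′ ≈ᶜ d f
    d-kernel f jf-cocycle =
      kernelCochain (d f) λ xs → trans (∗-d j f xs) (jf-cocycle xs)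

    d-kernel-cocycle : ∀ {r} (f : Cochain r A) (f′ : Cochain (suc r) A′) →
                       i ∗ f′ ≈ᶜ d f → IsCocycle f′
    d-kernel-cocycle f f′ if′≈df = ∗-injective (d f′) 0ᶜ λ xs → begin
      i.map (fun (d f′) xs)    ≡⟨ ∗-d i f′ xs ⟩
      fun (d (i ∗ f′)) xs      ≡⟨ d-cong {f = i ∗ f′} {d f} if′≈df xs ⟩
      fun (d (d f)) xs         ≡⟨ d-d A f xs ⟩
      A.𝟘                      ≡⟨ IsGroupHomomorphism.ε-homo i.isGroupHom ⟨
      i.map A′.𝟘               ∎
      where open ≡-Reasoning

    -- In degree 0 the hypothesis says that `j ∗ f` vanishes, so `t` is zero. In positive degree `t`
    -- is `d h` for a lift `h` of the primitive, and `f -ᶜ d h` is killed by `j`.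
    coboundary-split : ∀ {r} (f : Cochain r A) → IsCoboundary (j ∗ f) →
      Σ[ t ∈ Cochain r A ] IsCoboundary t × Σ[ f₀ ∈ Cochain r A′ ] f ≈ᶜ t +ᶜ i ∗ f₀
    coboundary-split {zero}  f (lift jf≈0) =
      let f₀ , if₀≈f = kernelCochain f jf≈0 in
      0ᶜ , lift (λ _ → refl) , f₀ , λ xs → trans (sym (if₀≈f xs)) (sym (Ab.identityˡ A _))
    coboundary-split {suc r} f (h″ , dh″≈jf) =
      let h , jh≈h″ = liftCochain h″
          f₀ , if₀≈ = kernelCochain (f -ᶜ d h) λ xs → begin
            j.map (fun (f -ᶜ d h) xs)
              ≡⟨ ∗-minus j f (d h) xs ⟩
            j.map (fun f xs) A″.⊕ A″.⊖ j.map (fun (d h) xs)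
              ≡⟨ cong (λ a → j.map (fun f xs) A″.⊕ A″.⊖ a)
                   (trans (∗-d j h xs) (trans (d-cong {f = j ∗ h} {h″} jh≈h″ xs) (dh″≈jf xs))) ⟩
            j.map (fun f xs) A″.⊕ A″.⊖ j.map (fun f xs)
              ≡⟨ Ab.inverseʳ A″ _ ⟩
            A″.𝟘 ∎
      in d h , (h , λ _ → refl) , f₀ , λ xs → begin
        fun f xs
          ≡⟨ xyx⁻¹≈y (fun (d h) xs) (fun f xs) ⟨
        fun (d h) xs A.⊕ fun f xs A.⊕ A.⊖ fun (d h) xs
          ≡⟨ Ab.assoc A _ _ _ ⟩
        fun (d h) xs A.⊕ (fun f xs A.⊕ A.⊖ fun (d h) xs)
          ≡⟨ cong (fun (d h) xs A.⊕_) (if₀≈ xs) ⟨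
        fun (d h) xs A.⊕ i.map (fun f₀ xs) ∎
      where
      open ≡-Reasoning
      open Ab A using (xyx⁻¹≈y)

    -- Applying `d` to the splitting kills `t`, which leaves the image of `d f₀` under `i`;
    -- injectivity of `i` concludes.
    d-kernel-split : ∀ {r} (f t : Cochain r A) (f₀ : Cochain r A′) (f′ : Cochain (suc r) A′) →
      i ∗ f′ ≈ᶜ d f → IsCoboundary t → f ≈ᶜ t +ᶜ i ∗ f₀ → f′ ≈ᶜ d f₀
    d-kernel-split f t f₀ f′ if′≈df t-cob f≈ = ∗-injective f′ (d f₀) λ xs → begin
      i.map (fun f′ xs)
        ≡⟨ if′≈df xs ⟩
      fun (d f) xs
        ≡⟨ d-cong {f = f} {t +ᶜ i ∗ f₀} f≈ xs ⟩
      fun (d (t +ᶜ i ∗ f₀)) xs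
        ≡⟨ d-+ t (i ∗ f₀) xs ⟩
      fun (d t) xs A.⊕ fun (d (i ∗ f₀)) xs
        ≡⟨ cong₂ A._⊕_ (coboundary⇒cocycle t t-cob xs) (sym (∗-d i f₀ xs)) ⟩
      A.𝟘 A.⊕ i.map (fun (d f₀) xs)
        ≡⟨ Ab.identityˡ A _ ⟩
      i.map (fun (d f₀) xs) ∎
      where open ≡-Reasoning

    lifts-exist : ∀ {r} (α : Class r A″) → ∃ λ (f : Cochain r A) → Lifts E f α
    lifts-exist {r} (a , a-cocycle) =
      let f , jf≈a = liftCochain a in
      f , (λ xs → trans (d-cong {f = j ∗ f} {a} jf≈a xs) (a-cocycle xs)) ,
      coboundary-0 (j ∗ f -ᶜ a) λ xs →
        trans (cong (A″._⊕ A″.⊖ fun a xs) (jf≈a xs)) (Ab.inverseʳ A″ _)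

    -- The chain `j ∗ f₁`, `α₁`, `α₂`, `j ∗ f₂` of equal classes. Allowing two representatives of
    -- one class serves both the independence of lifts and the congruence of the induced map.
    lifts-coboundary : ∀ {r} (α₁ α₂ : Class r A″) (f₁ f₂ : Cochain r A) → _≈ᴴ_ {r} {A″} α₁ α₂ →
      Lifts E f₁ α₁ → Lifts E f₂ α₂ → IsCoboundary (j ∗ (f₁ -ᶜ f₂))
    lifts-coboundary {r} α₁ α₂ f₁ f₂ α₁≈α₂ (z₁ , jf₁≈α₁) (z₂ , jf₂≈α₂) =
      coboundary-≈ (j ∗ f₁ -ᶜ j ∗ f₂) (j ∗ (f₁ -ᶜ f₂)) (λ xs → sym (∗-minus j f₁ f₂ xs))
        (H.trans {c₁} {α₂} {c₂} (H.trans {c₁} {α₁} {α₂} jf₁≈α₁ α₁≈α₂) (H.sym {c₂} {α₂} jf₂≈α₂))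
      where
      module H = Setoid (H r A″)
      c₁ = (j ∗ f₁ , z₁)
      c₂ = (j ∗ f₂ , z₂)

    d-kernel-minus : ∀ {r} (f₁ f₂ : Cochain r A) (f₁′ f₂′ : Cochain (suc r) A′) →
      i ∗ f₁′ ≈ᶜ d f₁ → i ∗ f₂′ ≈ᶜ d f₂ → i ∗ (f₁′ -ᶜ f₂′) ≈ᶜ d (f₁ -ᶜ f₂)
    d-kernel-minus f₁ f₂ f₁′ f₂′ p₁ p₂ xs = trans (∗-minus i f₁′ f₂′ xs)
      (trans (cong₂ (λ a b → a A.⊕ A.⊖ b) (p₁ xs) (p₂ xs)) (sym (d-minus f₁ f₂ xs)))

  -- Bilinearity of cup products, and products with cocycles.

  module _ {A B C : DiscreteModule} (pairing : Bilinear A B C) where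
    open Bilinear pairing
    private
      module B = DiscreteModule B
      module C = DiscreteModule C

    cup-cong : ∀ {r s} (f f₁ : Cochain r A) (g g₁ : Cochain s B) → f ≈ᶜ f₁ → g ≈ᶜ g₁ →
               cup pairing f g ≈ᶜ cup pairing f₁ g₁
    cup-cong {r} f f₁ g g₁ f≈f₁ g≈g₁ xs =
      cong₂ (λ a b → a ⊠ (foldr′ G._∙_ G.ε (take r xs) B.· b)) (f≈f₁ _) (g≈g₁ _)

    cup-+ˡ : ∀ {r s} (f f₁ : Cochain r A) (g : Cochain s B) →
             cup pairing (f +ᶜ f₁) g ≈ᶜ cup pairing f g +ᶜ cup pairing f₁ g
    cup-+ˡ f f₁ g xs = distribʳ _ _ _

    cup-+ʳ : ∀ {r s} (f : Cochain r A) (g g₁ : Cochain s B) →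
             cup pairing f (g +ᶜ g₁) ≈ᶜ cup pairing f g +ᶜ cup pairing f g₁
    cup-+ʳ f g g₁ xs = trans (cong (_ ⊠_) (B.·-distrib-⊕ _ _ _)) (distribˡ _ _ _)

    cup-negˡ : ∀ {r s} (f : Cochain r A) (g : Cochain s B) →
               cup pairing (negᶜ f) g ≈ᶜ negᶜ (cup pairing f g)
    cup-negˡ f g xs = additive-⊖ A C (⊠-additiveˡ pairing _) _

    cup-negʳ : ∀ {r s} (f : Cochain r A) (g : Cochain s B) →
               cup pairing f (negᶜ g) ≈ᶜ negᶜ (cup pairing f g)
    cup-negʳ f g xs = trans (cong (_ ⊠_) (additive-⊖ B B (B.·-distrib-⊕ _) _))
      (additive-⊖ B C (⊠-additiveʳ pairing _) _)

    cup-0ˡ : ∀ {r s} (f : Cochain r A) (g : Cochain s B) → f ≈ᶜ 0ᶜ → cup pairing f g ≈ᶜ 0ᶜ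
    cup-0ˡ f g f≈0 xs =
      trans (cong (_⊠ _) (f≈0 _)) (additive-𝟘 A C (⊠-additiveˡ pairing _))

    cup-0ʳ : ∀ {r s} (f : Cochain r A) (g : Cochain s B) → g ≈ᶜ 0ᶜ → cup pairing f g ≈ᶜ 0ᶜ
    cup-0ʳ f g g≈0 xs = trans
      (cong (λ b → _ ⊠ (_ B.· b)) (g≈0 _))
      (trans (cong (_ ⊠_) (additive-𝟘 B B (B.·-distrib-⊕ _)))
        (additive-𝟘 B C (⊠-additiveʳ pairing _)))

    fun-cup⁺ : ∀ {r s} (f : Cochain r A) (g : Cochain (suc s) B) xs →
               fun (cup⁺ pairing f g) xs ≡ fun (cup pairing f g) (cast (sym (+-suc r s)) xs)
    fun-cup⁺ {r} {s} f g = fun-subst (+-suc r s) (cup pairing f g)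

    cup⁺-cong : ∀ {r s} (f f₁ : Cochain r A) (g g₁ : Cochain (suc s) B) → f ≈ᶜ f₁ → g ≈ᶜ g₁ →
                cup⁺ pairing f g ≈ᶜ cup⁺ pairing f₁ g₁
    cup⁺-cong {r} {s} f f₁ g g₁ f≈f₁ g≈g₁ =
      subst-congᶜ (+-suc r s) (cup pairing f g) (cup pairing f₁ g₁) (cup-cong f f₁ g g₁ f≈f₁ g≈g₁)

    cup⁺-0ˡ : ∀ {r s} (f : Cochain r A) (g : Cochain (suc s) B) → f ≈ᶜ 0ᶜ → cup⁺ pairing f g ≈ᶜ 0ᶜ
    cup⁺-0ˡ f g f≈0 xs = trans (fun-cup⁺ f g xs) (cup-0ˡ f g f≈0 _)

    cup⁺-0ʳ : ∀ {r s} (f : Cochain r A) (g : Cochain (suc s) B) → g ≈ᶜ 0ᶜ → cup⁺ pairing f g ≈ᶜ 0ᶜ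
    cup⁺-0ʳ f g g≈0 xs = trans (fun-cup⁺ f g xs) (cup-0ʳ f g g≈0 _)

    cup⁺-+ˡ : ∀ {r s} (f f₁ : Cochain r A) (g : Cochain (suc s) B) →
              cup⁺ pairing (f +ᶜ f₁) g ≈ᶜ cup⁺ pairing f g +ᶜ cup⁺ pairing f₁ g
    cup⁺-+ˡ f f₁ g xs = trans (fun-cup⁺ (f +ᶜ f₁) g xs) (trans (cup-+ˡ f f₁ g _)
      (cong₂ C._⊕_ (sym (fun-cup⁺ f g xs)) (sym (fun-cup⁺ f₁ g xs))))

    cup⁺-+ʳ : ∀ {r s} (f : Cochain r A) (g g₁ : Cochain (suc s) B) →
              cup⁺ pairing f (g +ᶜ g₁) ≈ᶜ cup⁺ pairing f g +ᶜ cup⁺ pairing f g₁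
    cup⁺-+ʳ f g g₁ xs = trans (fun-cup⁺ f (g +ᶜ g₁) xs) (trans (cup-+ʳ f g g₁ _)
      (cong₂ C._⊕_ (sym (fun-cup⁺ f g xs)) (sym (fun-cup⁺ f g₁ xs))))

    cup⁺-negˡ : ∀ {r s} (f : Cochain r A) (g : Cochain (suc s) B) →
                cup⁺ pairing (negᶜ f) g ≈ᶜ negᶜ (cup⁺ pairing f g)
    cup⁺-negˡ f g xs = trans (fun-cup⁺ (negᶜ f) g xs)
      (trans (cup-negˡ f g _) (cong C.⊖_ (sym (fun-cup⁺ f g xs))))

    cup⁺-negʳ : ∀ {r s} (f : Cochain r A) (g : Cochain (suc s) B) →
                cup⁺ pairing f (negᶜ g) ≈ᶜ negᶜ (cup⁺ pairing f g)
    cup⁺-negʳ f g xs = trans (fun-cup⁺ f (negᶜ g) xs)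
      (trans (cup-negʳ f g _) (cong C.⊖_ (sym (fun-cup⁺ f g xs))))

    d-cup-cocycleˡ : ∀ {r s} (f : Cochain r A) (g : Cochain s B) → IsCocycle f → ∀ xs →
      fun (d (cup pairing f g)) xs ≡ sgn C.abelianGroup r (fun (cup⁺ pairing f (d g)) xs)
    d-cup-cocycleˡ {r} f g df≈0 xs = begin
      fun (d (cup pairing f g)) xs              ≡⟨ d-cup pairing f g xs ⟩
      fun (cup pairing (d f) g) xs C.⊕ w        ≡⟨ cong (C._⊕ w) (cup-0ˡ (d f) g df≈0 xs) ⟩
      C.𝟘 C.⊕ w                                 ≡⟨ Ab.identityˡ C w ⟩
      w                                         ∎
      where
      open ≡-Reasoning
      w = sgn C.abelianGroup r (fun (cup⁺ pairing f (d g)) xs)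

    d-cup-cocycleʳ : ∀ {r s} (f : Cochain r A) (g : Cochain s B) → IsCocycle g →
                     d (cup pairing f g) ≈ᶜ cup pairing (d f) g
    d-cup-cocycleʳ {r} f g dg≈0 xs = begin
      fun (d (cup pairing f g)) xs
        ≡⟨ d-cup pairing f g xs ⟩
      c C.⊕ sgn C.abelianGroup r (fun (cup⁺ pairing f (d g)) xs)
        ≡⟨ cong (λ c₁ → c C.⊕ sgn C.abelianGroup r c₁) (cup⁺-0ʳ f (d g) dg≈0 xs) ⟩
      c C.⊕ sgn C.abelianGroup r C.𝟘
        ≡⟨ cong (c C.⊕_) (sgn-ε C.abelianGroup r) ⟩
      c C.⊕ C.𝟘
        ≡⟨ Ab.identityʳ C c ⟩
      c ∎
      where
      open ≡-Reasoning
      c = fun (cup pairing (d f) g) xs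

    d-cup⁺-cocycleʳ : ∀ {r s} (f : Cochain r A) (g : Cochain (suc s) B) → IsCocycle g →
                      d (cup⁺ pairing f g) ≈ᶜ cup⁺ pairing (d f) g
    -- `+-suc (suc r) s` computes to `cong suc (+-suc r s)`, so the transport produced by `d-subst`
    -- is the one built into `cup⁺ pairing (d f) g`.
    d-cup⁺-cocycleʳ {r} {s} f g dg≈0 xs = trans (d-subst (+-suc r s) (cup pairing f g) xs)
      (subst-congᶜ (cong suc (+-suc r s)) (d (cup pairing f g)) (cup pairing (d f) g)
        (d-cup-cocycleʳ f g dg≈0) xs)

    cup⁺-coboundaryˡ : ∀ {r s} (f : Cochain r A) (g : Cochain (suc s) B) →
      IsCoboundary f → IsCocycle g → IsCoboundary (cup⁺ pairing f g)
    cup⁺-coboundaryˡ {zero}  f g (lift f≈0) dg≈0 =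
      coboundary-0 (cup⁺ pairing f g) (cup⁺-0ˡ f g f≈0)
    cup⁺-coboundaryˡ {suc r} f g (h , dh≈f) dg≈0 = cup⁺ pairing h g , λ xs →
      trans (d-cup⁺-cocycleʳ h g dg≈0 xs) (cup⁺-cong (d h) f g g dh≈f (λ _ → refl) xs)

    -- The left degree is a successor, as it is for `f′`, which makes the degree of the product a
    -- successor by computation.
    cup-coboundaryʳ : ∀ {r s} (f : Cochain (suc r) A) (g : Cochain s B) →
      IsCocycle f → IsCoboundary g → IsCoboundary (cup pairing f g)
    cup-coboundaryʳ {r} {zero}  f g df≈0 (lift g≈0) =
      coboundary-0 (cup pairing f g) (cup-0ʳ f g g≈0)
    cup-coboundaryʳ {r} {suc s} f g df≈0 (k , dk≈g) =
      coboundary-subst⁻ (+-suc r s) (cup pairing f g)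
        -- For the cocycle `f` of degree `suc r`, the Leibniz rule gives the coboundary of `f ∪ k`
        -- the sign of `suc r`; the primitive carries the same sign to undo it.
        ( sgnᶜ (suc r) (cup pairing f k) , λ xs → begin
          fun (d (sgnᶜ (suc r) (cup pairing f k))) xs
            ≡⟨ trans (d-sgn (suc r) (cup pairing f k) xs)
                 (fun-sgn (suc r) (d (cup pairing f k)) xs) ⟩
          sgn C.abelianGroup (suc r) (fun (d (cup pairing f k)) xs)
            ≡⟨ sgn-cong C.abelianGroup (suc r) (d-cup-cocycleˡ f k df≈0 xs) ⟩
          sgn C.abelianGroup (suc r) (sgn C.abelianGroup (suc r) (fun (cup⁺ pairing f (d k)) xs))
            ≡⟨ sgn-involutive C.abelianGroup (suc r) _ ⟩
          fun (cup⁺ pairing f (d k)) xs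
            ≡⟨ cup⁺-cong f f (d k) g (λ _ → refl) dk≈g xs ⟩
          fun (cup⁺ pairing f g) xs ∎ )
      where open ≡-Reasoning

  -- The augmented cup product of a Tate product.

  module _ (T : TateProduct) where
    open TateProduct T
    private
      module C = DiscreteModule C
      open Ab C
    open Bilinear pairing₁ using () renaming (_⊠_ to _⊠₁_)

    -- Equivariance of `iᴮ` moves the acting product of group elements onto `g′`, after which the
    -- pairings agree value by value.
    cup-coincide : ∀ {r s} (f′ : Cochain r A′) (g′ : Cochain s B′) →
                   cup pairing₁ f′ (iᴮ ∗ g′) ≈ᶜ cup pairing₂ (iᴬ ∗ f′) g′
    cup-coincide f′ g′ xs =
      trans (cong (_ ⊠₁_) (sym (ModuleHom.equivariant iᴮ _ _))) (coincide _ _)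

    cup⁺-coincide : ∀ {r s} (f′ : Cochain r A′) (g′ : Cochain (suc s) B′) →
                    cup⁺ pairing₁ f′ (iᴮ ∗ g′) ≈ᶜ cup⁺ pairing₂ (iᴬ ∗ f′) g′
    cup⁺-coincide {r} {s} f′ g′ =
      subst-congᶜ (+-suc r s) (cup pairing₁ f′ (iᴮ ∗ g′)) (cup pairing₂ (iᴬ ∗ f′) g′)
        (cup-coincide f′ g′)

    fun-augmented : ∀ {r s} (f : Cochain r A) (f′ : Cochain (suc r) A′)
      (g : Cochain s B) (g′ : Cochain (suc s) B′) xs →
      fun (augmented T f f′ g g′) xs ≡
        fun (cup pairing₁ f′ g) xs C.⊕ sgn C.abelianGroup r (fun (cup⁺ pairing₂ f g′) xs)
    fun-augmented {r} f f′ g g′ xs =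
      cong (fun (cup pairing₁ f′ g) xs C.⊕_) (fun-sgn r (cup⁺ pairing₂ f g′) xs)

    augmented-cocycle : ∀ {r s} (f : Cochain r A) (f′ : Cochain (suc r) A′)
      (g : Cochain s B) (g′ : Cochain (suc s) B′) → iᴬ ∗ f′ ≈ᶜ d f → iᴮ ∗ g′ ≈ᶜ d g →
      IsCocycle (augmented T f f′ g g′)
    augmented-cocycle {r} {s} f f′ g g′ if′≈df ig′≈dg xs = begin
      fun (d (augmented T f f′ g g′)) xs
        ≡⟨ d-+ (cup pairing₁ f′ g) (sgnᶜ r (cup⁺ pairing₂ f g′)) xs ⟩
      fun (d (cup pairing₁ f′ g)) xs
        C.⊕ fun (d (sgnᶜ r (cup⁺ pairing₂ f g′))) xs
        ≡⟨ cong₂ C._⊕_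
             (d-cup-cocycleˡ pairing₁ f′ g (d-kernel-cocycle A-exact f f′ if′≈df) xs)
             (trans (d-sgn r (cup⁺ pairing₂ f g′) xs) (fun-sgn r (d (cup⁺ pairing₂ f g′)) xs)) ⟩
      sgn C.abelianGroup (suc r) (fun (cup⁺ pairing₁ f′ (d g)) xs)
        C.⊕ sgn C.abelianGroup r (fun (d (cup⁺ pairing₂ f g′)) xs)
        -- Both summands become `(iᴬ ∗ f′) ∪ g′`. Their signs are opposite because `f′` has degree
        -- one more than `f`.
        ≡⟨ cong₂ (λ c c₁ → C.⊖ sgn C.abelianGroup r c C.⊕ sgn C.abelianGroup r c₁)
             (trans (cup⁺-cong pairing₁ f′ f′ (d g) (iᴮ ∗ g′) (λ _ → refl)
               (λ ys → sym (ig′≈dg ys)) xs)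
               (cup⁺-coincide f′ g′ xs))
             (trans (d-cup⁺-cocycleʳ pairing₂ f g′ (d-kernel-cocycle B-exact g g′ ig′≈dg) xs)
               (cup⁺-cong pairing₂ (d f) (iᴬ ∗ f′) g′ g′ (λ ys → sym (if′≈df ys))
                 (λ _ → refl) xs)) ⟩
      C.⊖ sgn C.abelianGroup r (fun (cup⁺ pairing₂ (iᴬ ∗ f′) g′) xs)
        C.⊕ sgn C.abelianGroup r (fun (cup⁺ pairing₂ (iᴬ ∗ f′) g′) xs)
        ≡⟨ inverseˡ _ ⟩
      C.𝟘 ∎
      where open ≡-Reasoning

    ⊕-sgn-minus : ∀ k u u₁ v v₁ →
      (u C.⊕ C.⊖ u₁) C.⊕ sgn C.abelianGroup k (v C.⊕ C.⊖ v₁)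
        ≡ (u C.⊕ sgn C.abelianGroup k v) C.⊕ C.⊖ (u₁ C.⊕ sgn C.abelianGroup k v₁)
    ⊕-sgn-minus k u u₁ v v₁ = begin
      (u C.⊕ C.⊖ u₁) C.⊕ sgn C.abelianGroup k (v C.⊕ C.⊖ v₁)
        ≡⟨ cong ((u C.⊕ C.⊖ u₁) C.⊕_) (sgn-∙ C.abelianGroup k v (C.⊖ v₁)) ⟩
      (u C.⊕ C.⊖ u₁) C.⊕ (w C.⊕ sgn C.abelianGroup k (C.⊖ v₁))
        ≡⟨ cong (λ c → (u C.⊕ C.⊖ u₁) C.⊕ (w C.⊕ c)) (sgn-⁻¹ C.abelianGroup k v₁) ⟩
      (u C.⊕ C.⊖ u₁) C.⊕ (w C.⊕ C.⊖ w₁)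
        ≡⟨ interchange u (C.⊖ u₁) w (C.⊖ w₁) ⟩
      (u C.⊕ w) C.⊕ (C.⊖ u₁ C.⊕ C.⊖ w₁)
        ≡⟨ cong ((u C.⊕ w) C.⊕_) (⁻¹-∙-comm u₁ w₁) ⟩
      (u C.⊕ w) C.⊕ C.⊖ (u₁ C.⊕ w₁) ∎
      where
      open ≡-Reasoning
      w  = sgn C.abelianGroup k v
      w₁ = sgn C.abelianGroup k v₁

    -- `f` and `f′` occur in different summands, so additivity holds only when the two vary together
    -- as a pair; likewise for `g` and `g′`.
    augmented-minusˡ : ∀ {r s} (f f₁ : Cochain r A) (f′ f₁′ : Cochain (suc r) A′)
      (g : Cochain s B) (g′ : Cochain (suc s) B′) →
      augmented T (f -ᶜ f₁) (f′ -ᶜ f₁′) g g′ ≈ᶜ augmented T f f′ g g′ -ᶜ augmented T f₁ f₁′ g g′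
    augmented-minusˡ {r} f f₁ f′ f₁′ g g′ xs = begin
      fun (augmented T (f -ᶜ f₁) (f′ -ᶜ f₁′) g g′) xs
        ≡⟨ fun-augmented (f -ᶜ f₁) (f′ -ᶜ f₁′) g g′ xs ⟩
      fun (cup pairing₁ (f′ -ᶜ f₁′) g) xs
        C.⊕ sgn C.abelianGroup r (fun (cup⁺ pairing₂ (f -ᶜ f₁) g′) xs)
        ≡⟨ cong₂ (λ c c₁ → c C.⊕ sgn C.abelianGroup r c₁)
             (trans (cup-+ˡ pairing₁ f′ (negᶜ f₁′) g xs)
               (cong (_ C.⊕_) (cup-negˡ pairing₁ f₁′ g xs)))
             (trans (cup⁺-+ˡ pairing₂ f (negᶜ f₁) g′ xs)
               (cong (_ C.⊕_) (cup⁺-negˡ pairing₂ f₁ g′ xs))) ⟩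
      _
        ≡⟨ ⊕-sgn-minus r (fun (cup pairing₁ f′ g) xs) (fun (cup pairing₁ f₁′ g) xs) _ _ ⟩
      _
        ≡⟨ cong₂ (λ c c₁ → c C.⊕ C.⊖ c₁) (fun-augmented f f′ g g′ xs)
             (fun-augmented f₁ f₁′ g g′ xs) ⟨
      fun (augmented T f f′ g g′ -ᶜ augmented T f₁ f₁′ g g′) xs ∎
      where open ≡-Reasoning

    augmented-minusʳ : ∀ {r s} (f : Cochain r A) (f′ : Cochain (suc r) A′)
      (g g₁ : Cochain s B) (g′ g₁′ : Cochain (suc s) B′) →
      augmented T f f′ (g -ᶜ g₁) (g′ -ᶜ g₁′) ≈ᶜ augmented T f f′ g g′ -ᶜ augmented T f f′ g₁ g₁′
    augmented-minusʳ {r} f f′ g g₁ g′ g₁′ xs = begin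
      fun (augmented T f f′ (g -ᶜ g₁) (g′ -ᶜ g₁′)) xs
        ≡⟨ fun-augmented f f′ (g -ᶜ g₁) (g′ -ᶜ g₁′) xs ⟩
      fun (cup pairing₁ f′ (g -ᶜ g₁)) xs
        C.⊕ sgn C.abelianGroup r (fun (cup⁺ pairing₂ f (g′ -ᶜ g₁′)) xs)
        ≡⟨ cong₂ (λ c c₁ → c C.⊕ sgn C.abelianGroup r c₁)
             (trans (cup-+ʳ pairing₁ f′ g (negᶜ g₁) xs)
               (cong (_ C.⊕_) (cup-negʳ pairing₁ f′ g₁ xs)))
             (trans (cup⁺-+ʳ pairing₂ f g′ (negᶜ g₁′) xs)
               (cong (_ C.⊕_) (cup⁺-negʳ pairing₂ f g₁′ xs))) ⟩
      _
        ≡⟨ ⊕-sgn-minus r (fun (cup pairing₁ f′ g) xs) (fun (cup pairing₁ f′ g₁) xs) _ _ ⟩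
      _
        ≡⟨ cong₂ (λ c c₁ → c C.⊕ C.⊖ c₁) (fun-augmented f f′ g g′ xs)
             (fun-augmented f f′ g₁ g₁′ xs) ⟨
      fun (augmented T f f′ g g′ -ᶜ augmented T f f′ g₁ g₁′) xs ∎
      where open ≡-Reasoning

    augmented-coboundaryˡ : ∀ {r s} (f : Cochain r A) (f′ : Cochain (suc r) A′)
      (g : Cochain s B) (g′ : Cochain (suc s) B′) → iᴬ ∗ f′ ≈ᶜ d f → iᴮ ∗ g′ ≈ᶜ d g →
      IsCoboundary (jᴬ ∗ f) → IsCoboundary (augmented T f f′ g g′)
    augmented-coboundaryˡ {r} {s} f f′ g g′ if′≈df ig′≈dg jf-cob =
      let t , t-cob , f₀ , f≈ = coboundary-split A-exact f jf-cob
          f′≈df₀ = d-kernel-split A-exact f t f₀ f′ if′≈df t-cob f≈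
          sgn-t = sgnᶜ r (cup⁺ pairing₂ t g′)
      in coboundary-≈ (sgn-t +ᶜ d (cup pairing₁ f₀ g)) (augmented T f f′ g g′)
        (λ xs → begin
          fun sgn-t xs C.⊕ fun (d (cup pairing₁ f₀ g)) xs
            ≡⟨ cong₂ C._⊕_ (fun-sgn r (cup⁺ pairing₂ t g′) xs) (d-cup pairing₁ f₀ g xs) ⟩
          sgn C.abelianGroup r (fun (cup⁺ pairing₂ t g′) xs)
            C.⊕ (fun (cup pairing₁ (d f₀) g) xs
                 C.⊕ sgn C.abelianGroup r (fun (cup⁺ pairing₁ f₀ (d g)) xs))
            -- With the unsigned term in front, the two signed terms combine. Since `f₀ ∪ d g` is
            -- `(iᴬ ∗ f₀) ∪ g′`, they add up to the product of `t +ᶜ iᴬ ∗ f₀`, that is of `f`, with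
            -- `g′`.
            ≡⟨ x∙yz≈y∙xz _ _ _ ⟩
          fun (cup pairing₁ (d f₀) g) xs
            C.⊕ (sgn C.abelianGroup r (fun (cup⁺ pairing₂ t g′) xs)
                 C.⊕ sgn C.abelianGroup r (fun (cup⁺ pairing₁ f₀ (d g)) xs))
            ≡⟨ cong₂ C._⊕_
                 (cup-cong pairing₁ (d f₀) f′ g g (λ ys → sym (f′≈df₀ ys)) (λ _ → refl) xs)
                 (sym (sgn-∙ C.abelianGroup r _ _)) ⟩
          fun (cup pairing₁ f′ g) xs
            C.⊕ sgn C.abelianGroup r
                  (fun (cup⁺ pairing₂ t g′) xs C.⊕ fun (cup⁺ pairing₁ f₀ (d g)) xs)
            ≡⟨ cong (λ c → _ C.⊕ sgn C.abelianGroup r (_ C.⊕ c))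
                 (trans (cup⁺-cong pairing₁ f₀ f₀ (d g) (iᴮ ∗ g′) (λ _ → refl)
                   (λ ys → sym (ig′≈dg ys)) xs)
                   (cup⁺-coincide f₀ g′ xs)) ⟩
          fun (cup pairing₁ f′ g) xs
            C.⊕ sgn C.abelianGroup r
                  (fun (cup⁺ pairing₂ t g′) xs C.⊕ fun (cup⁺ pairing₂ (iᴬ ∗ f₀) g′) xs)
            ≡⟨ cong (λ c → _ C.⊕ sgn C.abelianGroup r c)
                 (trans (sym (cup⁺-+ˡ pairing₂ t (iᴬ ∗ f₀) g′ xs))
                   (cup⁺-cong pairing₂ (t +ᶜ iᴬ ∗ f₀) f g′ g′ (λ ys → sym (f≈ ys))
                     (λ _ → refl) xs)) ⟩
          fun (cup pairing₁ f′ g) xs C.⊕ sgn C.abelianGroup r (fun (cup⁺ pairing₂ f g′) xs)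
            ≡⟨ fun-augmented f f′ g g′ xs ⟨
          fun (augmented T f f′ g g′) xs ∎)
        (coboundary-+ sgn-t (d (cup pairing₁ f₀ g))
          (coboundary-sgn r (cup⁺ pairing₂ t g′)
            (cup⁺-coboundaryˡ pairing₂ t g′ t-cob (d-kernel-cocycle B-exact g g′ ig′≈dg)))
          (cup pairing₁ f₀ g , λ _ → refl))
      where open ≡-Reasoning

    augmented-coboundaryʳ : ∀ {r s} (f : Cochain r A) (f′ : Cochain (suc r) A′)
      (g : Cochain s B) (g′ : Cochain (suc s) B′) → iᴬ ∗ f′ ≈ᶜ d f → iᴮ ∗ g′ ≈ᶜ d g →
      IsCoboundary (jᴮ ∗ g) → IsCoboundary (augmented T f f′ g g′)
    augmented-coboundaryʳ {r} {s} f f′ g g′ if′≈df ig′≈dg jg-cob =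
      let t , t-cob , g₀ , g≈ = coboundary-split B-exact g jg-cob
          g′≈dg₀ = d-kernel-split B-exact g t g₀ g′ ig′≈dg t-cob g≈
      in coboundary-≈ (cup pairing₁ f′ t +ᶜ d (cup pairing₂ f g₀)) (augmented T f f′ g g′)
        (λ xs → begin
          fun (cup pairing₁ f′ t) xs C.⊕ fun (d (cup pairing₂ f g₀)) xs
            ≡⟨ cong (_ C.⊕_) (d-cup pairing₂ f g₀ xs) ⟩
          fun (cup pairing₁ f′ t) xs
            C.⊕ (fun (cup pairing₂ (d f) g₀) xs
                 C.⊕ sgn C.abelianGroup r (fun (cup⁺ pairing₂ f (d g₀)) xs))
            ≡⟨ assoc _ _ _ ⟨
          fun (cup pairing₁ f′ t) xs C.⊕ fun (cup pairing₂ (d f) g₀) xs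
            C.⊕ sgn C.abelianGroup r (fun (cup⁺ pairing₂ f (d g₀)) xs)
            -- The product `d f ∪ g₀` passes from the second pairing to the first as
            -- `f′ ∪ (iᴮ ∗ g₀)`, ready to be added to `f′ ∪ t`.
            ≡⟨ cong₂ (λ c c₁ → _ C.⊕ c C.⊕ sgn C.abelianGroup r c₁)
                 (trans (cup-cong pairing₂ (d f) (iᴬ ∗ f′) g₀ g₀ (λ ys → sym (if′≈df ys))
                   (λ _ → refl) xs)
                   (sym (cup-coincide f′ g₀ xs)))
                 (cup⁺-cong pairing₂ f f (d g₀) g′ (λ _ → refl) (λ ys → sym (g′≈dg₀ ys)) xs) ⟩
          fun (cup pairing₁ f′ t) xs C.⊕ fun (cup pairing₁ f′ (iᴮ ∗ g₀)) xs
            C.⊕ sgn C.abelianGroup r (fun (cup⁺ pairing₂ f g′) xs)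
            ≡⟨ cong (C._⊕ _)
                 (trans (sym (cup-+ʳ pairing₁ f′ t (iᴮ ∗ g₀) xs))
                   (cup-cong pairing₁ f′ f′ (t +ᶜ iᴮ ∗ g₀) g (λ _ → refl)
                     (λ ys → sym (g≈ ys)) xs)) ⟩
          fun (cup pairing₁ f′ g) xs C.⊕ sgn C.abelianGroup r (fun (cup⁺ pairing₂ f g′) xs)
            ≡⟨ fun-augmented f f′ g g′ xs ⟨
          fun (augmented T f f′ g g′) xs ∎)
        (coboundary-+ (cup pairing₁ f′ t) (d (cup pairing₂ f g₀))
          (cup-coboundaryʳ pairing₁ f′ t (d-kernel-cocycle A-exact f f′ if′≈df) t-cob)
          (cup pairing₂ f g₀ , λ _ → refl))
      where open ≡-Reasoning

    -- First `f₁` is replaced by `f₂` with `g₁` fixed, then `g₁` by `g₂` with `f₂` fixed; each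
    -- difference is the augmented expression of a difference of lifts.
    augmented-cong : ∀ {r s}
      (f₁ f₂ : Cochain r A) (f₁′ f₂′ : Cochain (suc r) A′)
      (g₁ g₂ : Cochain s B) (g₁′ g₂′ : Cochain (suc s) B′) →
      iᴬ ∗ f₁′ ≈ᶜ d f₁ → iᴬ ∗ f₂′ ≈ᶜ d f₂ → iᴮ ∗ g₁′ ≈ᶜ d g₁ → iᴮ ∗ g₂′ ≈ᶜ d g₂ →
      IsCoboundary (jᴬ ∗ (f₁ -ᶜ f₂)) → IsCoboundary (jᴮ ∗ (g₁ -ᶜ g₂)) →
      IsCoboundary (augmented T f₁ f₁′ g₁ g₁′ -ᶜ augmented T f₂ f₂′ g₂ g₂′)
    augmented-cong {r} {s} f₁ f₂ f₁′ f₂′ g₁ g₂ g₁′ g₂′ p₁ p₂ q₁ q₂ jf-cob jg-cob =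
      Setoid.trans (H (suc (r + s)) C)
        {augmented T f₁ f₁′ g₁ g₁′ , augmented-cocycle f₁ f₁′ g₁ g₁′ p₁ q₁}
        {augmented T f₂ f₂′ g₁ g₁′ , augmented-cocycle f₂ f₂′ g₁ g₁′ p₂ q₁}
        {augmented T f₂ f₂′ g₂ g₂′ , augmented-cocycle f₂ f₂′ g₂ g₂′ p₂ q₂}
        (coboundary-≈ (augmented T (f₁ -ᶜ f₂) (f₁′ -ᶜ f₂′) g₁ g₁′)
          (augmented T f₁ f₁′ g₁ g₁′ -ᶜ augmented T f₂ f₂′ g₁ g₁′)
          (augmented-minusˡ f₁ f₂ f₁′ f₂′ g₁ g₁′)
          (augmented-coboundaryˡ (f₁ -ᶜ f₂) (f₁′ -ᶜ f₂′) g₁ g₁′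
            (d-kernel-minus A-exact f₁ f₂ f₁′ f₂′ p₁ p₂) q₁ jf-cob))
        (coboundary-≈ (augmented T f₂ f₂′ (g₁ -ᶜ g₂) (g₁′ -ᶜ g₂′))
          (augmented T f₂ f₂′ g₁ g₁′ -ᶜ augmented T f₂ f₂′ g₂ g₂′)
          (augmented-minusʳ f₂ f₂′ g₁ g₂ g₁′ g₂′)
          (augmented-coboundaryʳ f₂ f₂′ (g₁ -ᶜ g₂) (g₁′ -ᶜ g₂′)
            p₂ (d-kernel-minus B-exact g₁ g₂ g₁′ g₂′ q₁ q₂) jg-cob))

    augmented-class : ∀ {r s} (α₁ α₂ : Class r A″) (β₁ β₂ : Class s B″) →
      _≈ᴴ_ {r} {A″} α₁ α₂ → _≈ᴴ_ {s} {B″} β₁ β₂ →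
      (f₁ f₂ : Cochain r A) (g₁ g₂ : Cochain s B) →
      Lifts A-exact f₁ α₁ → Lifts A-exact f₂ α₂ → Lifts B-exact g₁ β₁ → Lifts B-exact g₂ β₂ →
      (f₁′ f₂′ : Cochain (suc r) A′) (g₁′ g₂′ : Cochain (suc s) B′) →
      iᴬ ∗ f₁′ ≈ᶜ d f₁ → iᴬ ∗ f₂′ ≈ᶜ d f₂ → iᴮ ∗ g₁′ ≈ᶜ d g₁ → iᴮ ∗ g₂′ ≈ᶜ d g₂ →
      IsCoboundary (augmented T f₁ f₁′ g₁ g₁′ -ᶜ augmented T f₂ f₂′ g₂ g₂′)
    augmented-class α₁ α₂ β₁ β₂ α₁≈α₂ β₁≈β₂ f₁ f₂ g₁ g₂ l₁ l₂ m₁ m₂ f₁′ f₂′ g₁′ g₂′ p₁ p₂ q₁ q₂ =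
      augmented-cong f₁ f₂ f₁′ f₂′ g₁ g₂ g₁′ g₂′ p₁ p₂ q₁ q₂
        (lifts-coboundary A-exact α₁ α₂ f₁ f₂ α₁≈α₂ l₁ l₂)
        (lifts-coboundary B-exact β₁ β₂ g₁ g₂ β₁≈β₂ m₁ m₂)

    -- The representatives come from the preimages that surjectivity of `j` selects;
    -- `augmentedCup-lifts` shows that any other lifts give the same class.
    augmentedCup : ∀ r s → Func (×-setoid (H r A″) (H s B″)) (H (suc (r + s)) C)
    augmentedCup r s = record
      { to   = λ (α , β) →
          let f , jf-cocycle , _ = lifts-exist A-exact {r} α
              g , jg-cocycle , _ = lifts-exist B-exact {s} β
              f′ , if′≈df = d-kernel A-exact f jf-cocycle
              g′ , ig′≈dg = d-kernel B-exact g jg-cocycle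
          in augmented T f f′ g g′ , augmented-cocycle f f′ g g′ if′≈df ig′≈dg
      ; cong = λ { {α₁ , β₁} {α₂ , β₂} (α₁≈α₂ , β₁≈β₂) →
          let f₁ , l₁ = lifts-exist A-exact {r} α₁
              f₂ , l₂ = lifts-exist A-exact {r} α₂
              g₁ , m₁ = lifts-exist B-exact {s} β₁
              g₂ , m₂ = lifts-exist B-exact {s} β₂
              f₁′ , p₁ = d-kernel A-exact f₁ (proj₁ l₁)
              f₂′ , p₂ = d-kernel A-exact f₂ (proj₁ l₂)
              g₁′ , q₁ = d-kernel B-exact g₁ (proj₁ m₁)
              g₂′ , q₂ = d-kernel B-exact g₂ (proj₁ m₂)
          in augmented-class α₁ α₂ β₁ β₂ α₁≈α₂ β₁≈β₂ f₁ f₂ g₁ g₂ l₁ l₂ m₁ m₂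
               f₁′ f₂′ g₁′ g₂′ p₁ p₂ q₁ q₂ }
      }

    augmentedCup-lifts : ∀ {r s} (α : Class r A″) (β : Class s B″)
      (f : Cochain r A) (g : Cochain s B) → Lifts A-exact f α → Lifts B-exact g β →
      (f′ : Cochain (suc r) A′) (g′ : Cochain (suc s) B′) → iᴬ ∗ f′ ≈ᶜ d f → iᴮ ∗ g′ ≈ᶜ d g →
      IsCoboundary (proj₁ (Func.to (augmentedCup r s) (α , β)) -ᶜ augmented T f f′ g g′)
    augmentedCup-lifts {r} {s} α β f g l m f′ g′ p q =
      let f₀ , l₀ = lifts-exist A-exact {r} α
          g₀ , m₀ = lifts-exist B-exact {s} β
          f₀′ , p₀ = d-kernel A-exact f₀ (proj₁ l₀)
          g₀′ , q₀ = d-kernel B-exact g₀ (proj₁ m₀)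
      -- The selected lifts are compared with the given ones, both lifting the same `α` and `β`.
      in augmented-class α α β β (Setoid.refl (H r A″) {α}) (Setoid.refl (H s B″) {β})
           f₀ f g₀ g l₀ l m₀ m f₀′ f′ g₀′ g′ p₀ p q₀ q

open CochainProducts using
  (d-kernel; lifts-exist; augmented-cocycle; augmented-class; augmentedCup; augmentedCup-lifts)

proposition3p5 :
  ∀ {ℓ} (G : ProfiniteGroup ℓ)
  (let open ContinuousCohomology (ProfiniteGroup.topologicalGroup G))
  (T : TateProduct)
  (let open TateProduct T)
  (r s : ℕ) →
  -- (a)
  ((α : Class r A″) (β : Class s B″) (f : Cochain r A) (g : Cochain s B) →
    Lifts A-exact f α → Lifts B-exact g β →
    (Σ[ f′ ∈ Cochain (suc r) A′ ] iᴬ ∗ f′ ≈ᶜ d f) ×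
    (Σ[ g′ ∈ Cochain (suc s) B′ ] iᴮ ∗ g′ ≈ᶜ d g))
  ×
  -- (b)
  ((α : Class r A″) (β : Class s B″) (f : Cochain r A) (g : Cochain s B) →
    Lifts A-exact f α → Lifts B-exact g β →
    (f′ : Cochain (suc r) A′) (g′ : Cochain (suc s) B′) →
    iᴬ ∗ f′ ≈ᶜ d f → iᴮ ∗ g′ ≈ᶜ d g →
    IsCocycle (augmented T f f′ g g′))
  ×
  -- (c)
  ((α : Class r A″) (β : Class s B″)
    (f₁ f₂ : Cochain r A) (g₁ g₂ : Cochain s B) →
    Lifts A-exact f₁ α → Lifts A-exact f₂ α →
    Lifts B-exact g₁ β → Lifts B-exact g₂ β →
    (f₁′ f₂′ : Cochain (suc r) A′) (g₁′ g₂′ : Cochain (suc s) B′) →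
    iᴬ ∗ f₁′ ≈ᶜ d f₁ → iᴬ ∗ f₂′ ≈ᶜ d f₂ →
    iᴮ ∗ g₁′ ≈ᶜ d g₁ → iᴮ ∗ g₂′ ≈ᶜ d g₂ →
    (z₁ : IsCocycle (augmented T f₁ f₁′ g₁ g₁′))
    (z₂ : IsCocycle (augmented T f₂ f₂′ g₂ g₂′)) →
    _≈ᴴ_ {suc (r + s)} {C} (augmented T f₁ f₁′ g₁ g₁′ , z₁) (augmented T f₂ f₂′ g₂ g₂′ , z₂))
  ×
  -- the augmented cup product
  ((α : Class r A″) → ∃ λ (f : Cochain r A) → Lifts A-exact f α)
  ×
  ((β : Class s B″) → ∃ λ (g : Cochain s B) → Lifts B-exact g β)
  ×
  (Σ[ ∪aug ∈ Func (×-setoid (H r A″) (H s B″)) (H (suc (r + s)) C) ]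
    ((α : Class r A″) (β : Class s B″) (f : Cochain r A) (g : Cochain s B) →
      Lifts A-exact f α → Lifts B-exact g β →
      (f′ : Cochain (suc r) A′) (g′ : Cochain (suc s) B′) →
      iᴬ ∗ f′ ≈ᶜ d f → iᴮ ∗ g′ ≈ᶜ d g →
      Σ[ z ∈ IsCocycle (augmented T f f′ g g′) ]
        _≈ᴴ_ {suc (r + s)} {C} (Func.to ∪aug (α , β)) (augmented T f f′ g g′ , z)))
proposition3p5 G T r s =
  (λ α β f g (jf-cocycle , _) (jg-cocycle , _) →
    d-kernel 𝔾 A-exact f jf-cocycle , d-kernel 𝔾 B-exact g jg-cocycle) ,
  (λ α β f g _ _ f′ g′ → augmented-cocycle 𝔾 T f f′ g g′) ,
  (λ α β f₁ f₂ g₁ g₂ l₁ l₂ m₁ m₂ f₁′ f₂′ g₁′ g₂′ p₁ p₂ q₁ q₂ _ _ →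
    augmented-class 𝔾 T α α β β (Hᴬ.refl {α}) (Hᴮ.refl {β})
      f₁ f₂ g₁ g₂ l₁ l₂ m₁ m₂ f₁′ f₂′ g₁′ g₂′ p₁ p₂ q₁ q₂) ,
  lifts-exist 𝔾 A-exact ,
  lifts-exist 𝔾 B-exact ,
  augmentedCup 𝔾 T r s ,
  λ α β f g l m f′ g′ p q →
    augmented-cocycle 𝔾 T f f′ g g′ p q ,
    augmentedCup-lifts 𝔾 T α β f g l m f′ g′ p q
  where
  𝔾 = ProfiniteGroup.topologicalGroup G
  open ContinuousCohomology 𝔾
  open TateProduct T
  module Hᴬ = Setoid (H r A″)
  module Hᴮ = Setoid (H s B″)
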